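{- For every integer $k\ge 2$ there is a constant $\theta>\log_2 3$ such that $\pi(\vec T_k,\theta)=1$.
   Context: A partially directed $k$-graph ($k$-PDG) on a vertex set $V$ specifies for each $k$-subset $S\subseteq V$ exactly one of: no edge on $S$; an undirected edge on $S$; or a directed edge on $S$ directed toward a chosen vertex of $S$. For an $n$-vertex $k$-PDG $\vec H$, let $\alpha(\vec H)=e_u(\vec H)/\binom nk$ and $\beta(\vec H)=e_d(\vec H)/\binom nk$, where $e_u,e_d$ are the numbers of undirected and directed edges. A $k$-PDG $\vec F$ is a subgraph of $\vec H$ if a $k$-PDG isomorphic to $\vec F$ can be obtained from $\vec H$ by a sequence of deleting edges, deleting vertices, and forgetting the direction of edges; $\vec H$ is $\vec F$-free if $\vec F$ is not a subgraph of it. $\vec T_k$ is the $k$-PDG on vertex set $\{1,\dots,k+1\}$ with undirected edges $\{1,\dots,k\}$ and $\{2,\dots,k+1\}$ and a directed edge $\{1,\dots,k-1,k+1\}$ directed toward $k+1$. For a $k$-PDG $\vec F$ and real $\theta$, $\pi(\vec F,\theta)$ is the smallest real number such that every $n$-vertex $\vec F$-free $k$-PDG $\vec H$ satisfies $\alpha(\vec H)+\theta\beta(\vec H)\le \pi(\vec F,\theta)+o_{n\to\infty}(1)$. -}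

module Defs where

open import Data.Nat using (ℕ; zero; suc; _+_; _≟_)
open import Data.Nat.Combinatorics using (_C_)
open import Data.Integer using (+_)
open import Data.Rational using (ℚ; _/_; 0ℚ)
import Data.Rational as ℚ
open import Data.Bool using (Bool; true; false; _∧_; _∨_)
open import Data.Fin using (Fin; zero; suc; toℕ)
import Data.Fin as Fin
open import Data.Fin.Subset using (Subset; Side; inside; outside; _∈_; ∣_∣)
open import Data.Vec using (Vec; []; _∷_; tabulate; lookup; _[_]=_)
open import Data.List using (List; []; _∷_; map; _++_; length; filter)
open import Data.Product using (Σ; ∃; _×_; _,_)
open import Function.Definitions using (Injective)
open import Relation.Binary.PropositionalEquality using (_≡_; _≢_)
open import Relation.Nullary using (Dec; yes; no; does; ¬_)
open import Data.Nat using (_<?_)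
import Data.Nat
import Data.Bool
open import Data.Bool using (if_then_else_)
open import Data.Vec.Properties using (≡-dec; lookup∘tabulate; lookup⇒[]=)
open import Data.Fin.Properties using (toℕ-fromℕ)
open import Relation.Nullary.Decidable using (dec-true)
open import Relation.Binary.PropositionalEquality using (refl; trans)

data Label (n : ℕ) : Set where
  none  : Label n
  undir : Label n
  dir   : Fin n → Label n

-- A k-PDG on vertex set Fin n.  Only labels of k-subsets are meaningful;
-- a directed edge on a k-subset S must point to a vertex of S.
record PDG (k n : ℕ) : Set where
  field
    lab : Subset n → Label n
    wf  : ∀ (S : Subset n) (v : Fin n) → ∣ S ∣ ≡ k → lab S ≡ dir v → v ∈ S
open PDG public

allSubsets : (n : ℕ) → List (Subset n)
allSubsets zero = [] ∷ []
allSubsets (suc n) = map (inside ∷_) (allSubsets n) ++ map (outside ∷_) (allSubsets n)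

isUndir : ∀ {n} → Label n → Bool
isUndir undir = true
isUndir _     = false

isDir : ∀ {n} → Label n → Bool
isDir (dir _) = true
isDir _       = false

isK : ∀ {n} → ℕ → Subset n → Bool
isK k S = does (∣ S ∣ ≟ k)

count : ∀ {n} → (Subset n → Bool) → ℕ
count {n} p = length (filter (λ S → p S Data.Bool.≟ true) (allSubsets n))

eᵤ : ∀ {k n} → PDG k n → ℕ
eᵤ {k} H = count (λ S → isK k S ∧ isUndir (lab H S))

e𝒹 : ∀ {k n} → PDG k n → ℕ
e𝒹 {k} H = count (λ S → isK k S ∧ isDir (lab H S))

anyFin : ∀ {m} → (Fin m → Bool) → Bool
anyFin {zero}  p = false
anyFin {suc m} p = p zero ∨ anyFin (λ i → p (suc i))

image : ∀ {m n} → (Fin m → Fin n) → Subset m → Subset n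
image φ S = tabulate λ j → anyFin λ i → lookup S i ∧ does (φ i Fin.≟ j)

-- F is a subgraph of H (delete edges, delete vertices, forget directions,
-- up to isomorphism): an injective vertex map sending every undirected edge
-- of F to an edge of H and every directed edge of F toward v to a directed
-- edge of H toward the image of v.
_⊆ᴾ_ : ∀ {k m n} → PDG k m → PDG k n → Set
_⊆ᴾ_ {k} {m} {n} F H =
  Σ (Fin m → Fin n) λ φ → Injective _≡_ _≡_ φ ×
    (∀ (S : Subset m) → ∣ S ∣ ≡ k →
       (lab F S ≡ undir → lab H (image φ S) ≢ none) ×
       (∀ v → lab F S ≡ dir v → lab H (image φ S) ≡ dir (φ v)))

_isFreeOf_ : ∀ {k m n} → PDG k n → PDG k m → Set
H isFreeOf F = ¬ (F ⊆ᴾ H)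

-- The k-PDG T_k on vertex set Fin (k+1) (paper's vertex i is Fin index i-1):
-- undirected edges {0..k-1} and {1..k}, directed edge {0..k-2, k} toward k.
e₃ : (k : ℕ) → Fin (suc k) → Bool
e₃ k i = does (suc (toℕ i) <? k) ∨ does (toℕ i ≟ k)

E₁ E₂ E₃ : (k : ℕ) → Subset (suc k)
E₁ k = tabulate λ i → does (toℕ i <? k)
E₂ k = tabulate λ i → does (0 <? toℕ i)
E₃ k = tabulate (e₃ k)

_≟ˢ_ : ∀ {n} (S T : Subset n) → Dec (S ≡ T)
_≟ˢ_ = ≡-dec Data.Bool._≟_

labT : (k : ℕ) → Subset (suc k) → Label (suc k)
labT k S = if does (S ≟ˢ E₃ k) then dir (Fin.fromℕ k)
           else if does (S ≟ˢ E₁ k) ∨ does (S ≟ˢ E₂ k) then undir else none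

private
  lastInE₃ : ∀ k → Fin.fromℕ k ∈ E₃ k
  lastInE₃ k = lookup⇒[]= (Fin.fromℕ k) (E₃ k)
    (trans (lookup∘tabulate (e₃ k) (Fin.fromℕ k)) (aux (suc (toℕ (Fin.fromℕ k)) <? k)))
    where
    aux : ∀ (d : Dec (suc (toℕ (Fin.fromℕ k)) Data.Nat.< k)) →
          does d ∨ does (toℕ (Fin.fromℕ k) ≟ k) ≡ true
    aux (yes _) = refl
    aux (no _) = dec-true (toℕ (Fin.fromℕ k) ≟ k) (toℕ-fromℕ k)

  wfT : ∀ k (S : Subset (suc k)) v → ∣ S ∣ ≡ k → labT k S ≡ dir v → v ∈ S
  wfT k S v _ eq with S ≟ˢ E₃ k
  wfT k S v _ refl | yes refl = lastInE₃ k
  ... | no _ with does (S ≟ˢ E₁ k) ∨ does (S ≟ˢ E₂ k)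
  wfT k S v _ () | no _ | true
  wfT k S v _ () | no _ | false

T : (k : ℕ) → PDG k (suc k)
T k = record { lab = labT k ; wf = wfT k }

toℚ : ℕ → ℚ
toℚ n = + n / 1

-- e_u(H) + θ e_d(H)  (= (α(H) + θ β(H)) · C(n,k))
weighted : ∀ {k n} → ℚ → PDG k n → ℚ
weighted θ H = toℚ (eᵤ H) ℚ.+ θ ℚ.* toℚ (e𝒹 H)

-- c is an asymptotic upper bound: every n-vertex F-free k-PDG H satisfies
-- α(H) + θ β(H) ≤ c + o(1), i.e. for every ε > 0 and all large n,
-- e_u + θ e_d ≤ (c + ε) C(n,k).
BoundWorks : ∀ {k m} → PDG k m → ℚ → ℚ → Set
BoundWorks {k} F θ c =
  ∀ (ε : ℚ) → 0ℚ ℚ.< ε → Σ ℕ λ n₀ → ∀ (n : ℕ) → n₀ Data.Nat.≤ n →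
    (H : PDG k n) → H isFreeOf F → weighted θ H ℚ.≤ (c ℚ.+ ε) ℚ.* toℚ (n C k)

πIs : ∀ {k m} → PDG k m → ℚ → ℚ → Set
πIs F θ c = BoundWorks F θ c × (∀ (c′ : ℚ) → c′ ℚ.< c → ¬ BoundWorks F θ c′)

Log₂3< : ℚ → Set
Log₂3< θ = Σ ℕ λ p → Σ ℕ λ q → (θ ≡ (+ p) / suc q) × (3 Data.Nat.^ suc q Data.Nat.< 2 Data.Nat.^ p)

{-# OPTIONS --safe #-}

-- Write d(P) for the number of edges containing a (k−1)-set P.  If S is directed towards v then, by
-- T_k-freeness, no x outside S makes both S − v + x and S − u + x (u ≠ v) an edge.  Put M = n − k + 1
-- and let B(S) count the x outside S for which S − v + x is an edge; so d(S − v) = 1 + B(S) and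
-- d(S − u) ≤ M − B(S).  Two estimates are combined.
-- (1) The sum of 1/d(P) over the edges containing P is at most 1.  Summing over all P bounds the number
--     of edges, with a surplus from each directed edge that is large when B(S) is small.
-- (2) If W = S + x has S directed towards v and W − v an edge, then W contains no third edge, so a
--     large sum of the B(S) forces many (k+1)-sets with only two edges, hence few edges overall.
-- The surplus in (1) and the loss in (2) balance at B(S) of order M/k, where together they give
-- e_u + (27/17) e_d ≤ C(n,k) for all large n, and 27/17 > log₂ 3.

module Submission where

open import Defs
open import Data.Nat using (ℕ; _≤_)
open import Data.Rational using (ℚ; 1ℚ)
open import Data.Product using (Σ; _×_)

open import Data.Bool using (Bool; true; false; not; _∧_; _∨_; if_then_else_)
import Data.Bool
open import Data.Bool.Properties using (∧-identityʳ; ∧-zeroʳ)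
open import Data.Empty using (⊥; ⊥-elim)
open import Data.Fin using (Fin; zero; suc; toℕ; fromℕ; inject₁)
import Data.Fin as Fin
open import Data.Fin.Permutation.Components using (transpose; transpose-inverse)
open import Data.Fin.Properties using (suc-injective; toℕ-fromℕ; toℕ-inject₁; toℕ-injective; toℕ<n; fromℕ≢inject₁; any?)
open import Data.Fin.Subset using (Subset; inside; outside; ∣_∣; ⊤)
open import Data.Fin.Subset.Properties using (∣⊤∣≡n)
open import Data.Integer using (ℤ; +_; -[1+_]; 0ℤ; 1ℤ; _+_; _*_; _-_; -_; _<_; +≤+; +<+; nonNegative; positive)
import Data.Integer as ℤ
open import Data.Integer.Properties
open import Data.Integer.Tactic.RingSolver using (solve-∀)
open import Data.List using (List; []; _∷_; map; _++_; length; filter)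
open import Data.List.Properties using (filter-++; length-++)
open import Data.Nat using (zero; suc; z≤n; s≤s)
import Data.Nat as ℕ
import Data.Nat.Properties as ℕ
open import Data.Nat.Combinatorics using (_C_; nCk+nC[k+1]≡[n+1]C[k+1])
open import Data.Product using (∃; _,_; proj₁; proj₂)
open import Data.Rational using (_/_; toℚᵘ)
import Data.Rational as ℚ
import Data.Rational.Properties as ℚ
open import Data.Rational.Unnormalised using (mkℚᵘ; *≤*)
import Data.Rational.Unnormalised as ℚᵘ
import Data.Rational.Unnormalised.Properties as ℚᵘ
open import Data.Sum using (_⊎_; inj₁; inj₂)
open import Data.Vec using ([]; _∷_; lookup; _[_]≔_)
open import Data.Vec.Properties using ([]≔-idempotent; []≔-lookup; []≔-commutes; []=⇒lookup; lookup∘updateAt; lookup∘updateAt′; lookup∘tabulate; lookup-replicate; tabulate∘lookup; tabulate-cong)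
open import Function using (_∘_)
open import Function.Definitions using (Injective)
open import Relation.Binary.PropositionalEquality hiding (J)
open import Relation.Nullary using (Dec; yes; no; does; ¬_; contradiction)
open import Relation.Nullary.Decidable using (dec-true; dec-false)
open import Algebra.Properties.Semiring.Sum +-*-semiring using (sum; sum-cong-≗; ∑-distrib-+; *-distribˡ-sum; *-distribʳ-sum)

-- Sums over subsets

-- Counts take values in ℤ because the tangent bounds involve subtraction.
𝟙 : Bool → ℤ
𝟙 b = if b then 1ℤ else 0ℤ

0≤𝟙 : ∀ b → 0ℤ ℤ.≤ 𝟙 b
0≤𝟙 true  = +≤+ ℕ.z≤n
0≤𝟙 false = +≤+ ℕ.z≤n

𝟙≤1 : ∀ b → 𝟙 b ℤ.≤ 1ℤ
𝟙≤1 true  = +≤+ (ℕ.s≤s ℕ.z≤n)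
𝟙≤1 false = +≤+ ℕ.z≤n

𝟙-mono : ∀ {a b} → (a ≡ true → b ≡ true) → 𝟙 a ℤ.≤ 𝟙 b
𝟙-mono {false} {b} _ = 0≤𝟙 b
𝟙-mono {true} imp rewrite imp refl = ≤-refl

𝟙-∧ : ∀ a b → 𝟙 (a ∧ b) ≡ 𝟙 a * 𝟙 b
𝟙-∧ true  b = sym (*-identityˡ (𝟙 b))
𝟙-∧ false b = refl

𝟙*-cong : ∀ b {x y} → (b ≡ true → x ≡ y) → 𝟙 b * x ≡ 𝟙 b * y
𝟙*-cong true  x≡y = cong (1ℤ *_) (x≡y refl)
𝟙*-cong false x≡y = refl

𝟙*-mono : ∀ b {x y} → (b ≡ true → x ℤ.≤ y) → 𝟙 b * x ℤ.≤ 𝟙 b * y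
𝟙*-mono true  x≤y = *-monoˡ-≤-nonNeg 1ℤ (x≤y refl)
𝟙*-mono false x≤y = ≤-refl

0≤+ : ∀ {x y} → 0ℤ ℤ.≤ x → 0ℤ ℤ.≤ y → 0ℤ ℤ.≤ x + y
0≤+ = +-mono-≤

0≤* : ∀ {x y} → 0ℤ ℤ.≤ x → 0ℤ ℤ.≤ y → 0ℤ ℤ.≤ x * y
0≤* {+ m} {+ n} _ _ = subst (0ℤ ℤ.≤_) (pos-* m n) (+≤+ ℕ.z≤n)

0≤x*x : ∀ x → 0ℤ ℤ.≤ x * x
0≤x*x (+ n)    = 0≤* {+ n} {+ n} (+≤+ ℕ.z≤n) (+≤+ ℕ.z≤n)
0≤x*x -[1+ n ] = +≤+ ℕ.z≤n

sum-mono : ∀ {n} {f g : Fin n → ℤ} → (∀ i → f i ℤ.≤ g i) → sum f ℤ.≤ sum g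
sum-mono {zero}  f≤g = ≤-refl
sum-mono {suc n} f≤g = +-mono-≤ (f≤g zero) (sum-mono (f≤g ∘ suc))

sum-0 : ∀ {n} {f : Fin n → ℤ} → (∀ i → f i ≡ 0ℤ) → sum f ≡ 0ℤ
sum-0 {zero}  f≡0 = refl
sum-0 {suc n} f≡0 = cong₂ _+_ (f≡0 zero) (sum-0 (f≡0 ∘ suc))

0≤sum : ∀ {n} {f : Fin n → ℤ} → (∀ i → 0ℤ ℤ.≤ f i) → 0ℤ ℤ.≤ sum f
0≤sum {zero}  0≤f = ≤-refl
0≤sum {suc n} 0≤f = 0≤+ (0≤f zero) (0≤sum (0≤f ∘ suc))

term≤sum : ∀ {n} {f : Fin n → ℤ} → (∀ i → 0ℤ ℤ.≤ f i) → ∀ i → f i ℤ.≤ sum f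
term≤sum {suc n} {f} 0≤f zero    = subst (ℤ._≤ sum f) (+-identityʳ (f zero)) (+-monoʳ-≤ (f zero) (0≤sum (0≤f ∘ suc)))
term≤sum {suc n} {f} 0≤f (suc i) = subst (ℤ._≤ sum f) (+-identityˡ (f (suc i))) (+-mono-≤ (0≤f zero) (term≤sum (0≤f ∘ suc) i))

sum-δ : ∀ {n} (v : Fin n) → sum (λ u → 𝟙 (does (u Fin.≟ v))) ≡ 1ℤ
sum-δ {suc n} zero    = cong (λ z → 1ℤ + z) (sum-0 {n} (λ _ → refl))
sum-δ {suc n} (suc v) = trans (+-identityˡ _) (sum-δ v)

-- The tangent bound Q²/d ≥ 2Qt − t²d, summed over the d indices selected by w.
selected-tangent-bound : ∀ {n} (w : Fin n → Bool) (t : Fin n → ℤ) (Q : ℤ) →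
  sum (λ x → 𝟙 (w x) * (+ 2 * Q * t x - t x * t x * sum (𝟙 ∘ w))) ℤ.≤ Q * Q
selected-tangent-bound w t Q with sum (𝟙 ∘ w) in eq
... | -[1+ m ] = contradiction (subst (0ℤ ℤ.≤_) eq (0≤sum (0≤𝟙 ∘ w))) λ ()
... | + zero = subst (ℤ._≤ Q * Q) (sym (sum-0 vanish)) (0≤x*x Q)
  where
  vanish : ∀ x → 𝟙 (w x) * (+ 2 * Q * t x - t x * t x * 0ℤ) ≡ 0ℤ
  vanish x with w x | subst (𝟙 (w x) ℤ.≤_) eq (term≤sum (0≤𝟙 ∘ w) x)
  ... | false | _ = refl
  ... | true  | +≤+ ()
-- Multiplying by d avoids division: each selected index then falls short of Q² by the square (Q - t
-- d)², and Q² is counted d times.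
... | d@(+ suc m) = *-cancelˡ-≤-pos (sum f) (Q * Q) d (begin
  d * sum f                        ≡⟨ *-distribˡ-sum d f ⟩
  sum (λ x → d * f x)              ≤⟨ sum-mono pointwise ⟩
  sum (λ x → Q * Q * 𝟙 (w x))      ≡⟨ *-distribˡ-sum (Q * Q) (𝟙 ∘ w) ⟨
  Q * Q * sum (𝟙 ∘ w)              ≡⟨ cong (Q * Q *_) eq ⟩
  Q * Q * d                        ≡⟨ *-comm (Q * Q) d ⟩
  d * (Q * Q)                      ∎)
  where
  open ≤-Reasoning
  f = λ x → 𝟙 (w x) * (+ 2 * Q * t x - t x * t x * d)
  square : ∀ b Q t d → Q * Q * b ≡ d * (b * (+ 2 * Q * t - t * t * d)) + b * ((Q - t * d) * (Q - t * d))
  square = solve-∀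
  pointwise : ∀ x → d * f x ℤ.≤ Q * Q * 𝟙 (w x)
  pointwise x = begin
    d * f x        ≡⟨ +-identityʳ _ ⟨
    d * f x + 0ℤ   ≤⟨ +-monoʳ-≤ (d * f x) (0≤* (0≤𝟙 (w x)) (0≤x*x (Q - t x * d))) ⟩
    d * f x + 𝟙 (w x) * ((Q - t x * d) * (Q - t x * d)) ≡⟨ square (𝟙 (w x)) Q (t x) d ⟨
    Q * Q * 𝟙 (w x) ∎

-- Recursion on the characteristic vector instead of the list `allSubsets` turns identities such as
-- `∑ˢ-toggle` into structural inductions; `count-∑ˢ` links the two.
∑ˢ : ∀ {n} → (Subset n → ℤ) → ℤ
∑ˢ {zero}  f = f []
∑ˢ {suc n} f = ∑ˢ (f ∘ (inside ∷_)) + ∑ˢ (f ∘ (outside ∷_))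

∑ˢ-cong : ∀ {n} {f g : Subset n → ℤ} → (∀ S → f S ≡ g S) → ∑ˢ f ≡ ∑ˢ g
∑ˢ-cong {zero}  f≡g = f≡g []
∑ˢ-cong {suc n} f≡g = cong₂ _+_ (∑ˢ-cong (f≡g ∘ (inside ∷_))) (∑ˢ-cong (f≡g ∘ (outside ∷_)))

∑ˢ-mono : ∀ {n} {f g : Subset n → ℤ} → (∀ S → f S ℤ.≤ g S) → ∑ˢ f ℤ.≤ ∑ˢ g
∑ˢ-mono {zero}  f≤g = f≤g []
∑ˢ-mono {suc n} f≤g = +-mono-≤ (∑ˢ-mono (f≤g ∘ (inside ∷_))) (∑ˢ-mono (f≤g ∘ (outside ∷_)))

∑ˢ-0 : ∀ n → ∑ˢ {n} (λ _ → 0ℤ) ≡ 0ℤ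
∑ˢ-0 zero    = refl
∑ˢ-0 (suc n) = cong₂ _+_ (∑ˢ-0 n) (∑ˢ-0 n)

∑ˢ-distrib-+ : ∀ {n} (f g : Subset n → ℤ) → ∑ˢ (λ S → f S + g S) ≡ ∑ˢ f + ∑ˢ g
∑ˢ-distrib-+ {zero}  f g = refl
∑ˢ-distrib-+ {suc n} f g = trans
  (cong₂ _+_ (∑ˢ-distrib-+ (f ∘ (inside ∷_)) (g ∘ (inside ∷_)))
             (∑ˢ-distrib-+ (f ∘ (outside ∷_)) (g ∘ (outside ∷_))))
  (interchange (∑ˢ (f ∘ (inside ∷_))) (∑ˢ (g ∘ (inside ∷_))) (∑ˢ (f ∘ (outside ∷_))) (∑ˢ (g ∘ (outside ∷_))))
  where
  interchange : ∀ a b c d → (a + b) + (c + d) ≡ (a + c) + (b + d)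
  interchange = solve-∀

*-distribˡ-∑ˢ : ∀ {n} x (f : Subset n → ℤ) → x * ∑ˢ f ≡ ∑ˢ (λ S → x * f S)
*-distribˡ-∑ˢ {zero}  x f = refl
*-distribˡ-∑ˢ {suc n} x f = trans (*-distribˡ-+ x _ _)
  (cong₂ _+_ (*-distribˡ-∑ˢ x (f ∘ (inside ∷_))) (*-distribˡ-∑ˢ x (f ∘ (outside ∷_))))

∑ˢ-sum-comm : ∀ {n m} (f : Subset n → Fin m → ℤ) →
  ∑ˢ (λ S → sum (f S)) ≡ sum (λ i → ∑ˢ (λ S → f S i))
∑ˢ-sum-comm {n} {zero}  f = ∑ˢ-0 n
∑ˢ-sum-comm {n} {suc m} f = trans (∑ˢ-distrib-+ (λ S → f S zero) (λ S → sum (f S ∘ suc)))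
  (cong (λ z → ∑ˢ (λ S → f S zero) + z) (∑ˢ-sum-comm (λ S → f S ∘ suc)))

insert delete : ∀ {n} → Subset n → Fin n → Subset n
insert S x = S [ x ]≔ inside
delete S x = S [ x ]≔ outside

_∈ᵇ_ _∉ᵇ_ : ∀ {n} → Fin n → Subset n → Bool
x ∈ᵇ S = lookup S x
x ∉ᵇ S = not (lookup S x)

not-true : ∀ {b} → not b ≡ true → b ≡ false
not-true {false} _ = refl

delete-insert : ∀ {n} (S : Subset n) x → x ∉ᵇ S ≡ true → delete (insert S x) x ≡ S
delete-insert S x x∉S = trans ([]≔-idempotent S x)
  (trans (cong (S [ x ]≔_) (sym (not-true x∉S))) ([]≔-lookup S x))

insert-delete : ∀ {n} (S : Subset n) x → x ∈ᵇ S ≡ true → insert (delete S x) x ≡ S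
insert-delete S x x∈S = trans ([]≔-idempotent S x)
  (trans (cong (S [ x ]≔_) (sym x∈S)) ([]≔-lookup S x))

∣insert∣ : ∀ {n} (S : Subset n) x → x ∉ᵇ S ≡ true → ∣ insert S x ∣ ≡ suc ∣ S ∣
∣insert∣ (outside ∷ S) zero    _   = refl
∣insert∣ (inside  ∷ S) (suc x) x∉S = cong suc (∣insert∣ S x x∉S)
∣insert∣ (outside ∷ S) (suc x) x∉S = ∣insert∣ S x x∉S

∣delete∣ : ∀ {n} (S : Subset n) x → x ∈ᵇ S ≡ true → suc ∣ delete S x ∣ ≡ ∣ S ∣
∣delete∣ (inside  ∷ S) zero    _   = refl
∣delete∣ (inside  ∷ S) (suc x) x∈S = cong suc (∣delete∣ S x x∈S)
∣delete∣ (outside ∷ S) (suc x) x∈S = ∣delete∣ S x x∈S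

sum-∈ : ∀ {n} (S : Subset n) → sum (λ u → 𝟙 (u ∈ᵇ S)) ≡ + ∣ S ∣
sum-∈ []            = refl
sum-∈ (inside  ∷ S) = cong (λ z → 1ℤ + z) (sum-∈ S)
sum-∈ (outside ∷ S) = trans (+-identityˡ _) (sum-∈ S)

sum-∉ : ∀ {n} (S : Subset n) → sum (λ u → 𝟙 (u ∉ᵇ S)) + + ∣ S ∣ ≡ + n
sum-∉ []            = refl
sum-∉ (outside ∷ S) = trans (+-assoc 1ℤ (sum (λ u → 𝟙 (u ∉ᵇ S))) (+ ∣ S ∣)) (cong (λ z → 1ℤ + z) (sum-∉ S))
sum-∉ {suc n} (inside ∷ S) = trans (shift (sum (λ u → 𝟙 (u ∉ᵇ S))) (+ ∣ S ∣)) (cong (λ z → 1ℤ + z) (sum-∉ S))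
  where
  shift : ∀ a b → (0ℤ + a) + (1ℤ + b) ≡ 1ℤ + (a + b)
  shift = solve-∀

-- S ↦ S - u is a bijection from the sets containing u to those avoiding it. If u is the first
-- coordinate, the two halves of the sum trade places.
∑ˢ-toggle : ∀ {n} u (g : Subset n → ℤ) →
  ∑ˢ (λ S → 𝟙 (u ∈ᵇ S) * g S) ≡ ∑ˢ (λ P → 𝟙 (u ∉ᵇ P) * g (insert P u))
∑ˢ-toggle {suc n} zero g = +-comm (∑ˢ (λ S → 1ℤ * g (inside ∷ S))) (∑ˢ {n} (λ _ → 0ℤ))
∑ˢ-toggle (suc u) g = cong₂ _+_ (∑ˢ-toggle u (g ∘ (inside ∷_))) (∑ˢ-toggle u (g ∘ (outside ∷_)))

-- Pairs u ∈ S correspond to pairs x ∉ P through P = S - u and x = u. This moves sums between sets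
-- of consecutive sizes.
double-count : ∀ {n} (G : Subset n → Fin n → ℤ) →
  ∑ˢ (λ S → sum λ u → 𝟙 (u ∈ᵇ S) * G S u) ≡ ∑ˢ (λ P → sum λ x → 𝟙 (x ∉ᵇ P) * G (insert P x) x)
double-count G = trans (∑ˢ-sum-comm (λ S u → 𝟙 (u ∈ᵇ S) * G S u))
  (trans (sum-cong-≗ (λ u → ∑ˢ-toggle u (λ S → G S u)))
         (sym (∑ˢ-sum-comm (λ P x → 𝟙 (x ∉ᵇ P) * G (insert P x) x))))

double-count′ : ∀ {n} (F : Subset n → Fin n → ℤ) →
  ∑ˢ (λ P → sum λ x → 𝟙 (x ∉ᵇ P) * F P x) ≡ ∑ˢ (λ S → sum λ u → 𝟙 (u ∈ᵇ S) * F (delete S u) u)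
double-count′ F = sym (trans (double-count (λ S u → F (delete S u) u))
  (∑ˢ-cong λ P → sum-cong-≗ λ x → 𝟙*-cong (x ∉ᵇ P) λ x∉P → cong (λ R → F R x) (delete-insert P x x∉P)))

count-∑ˢ : ∀ {n} (p : Subset n → Bool) → + count p ≡ ∑ˢ (𝟙 ∘ p)
count-∑ˢ {zero} p with p []
... | true  = refl
... | false = refl
count-∑ˢ {suc n} p = begin
  + length (filter p? (map (inside ∷_) A ++ map (outside ∷_) A))
    ≡⟨ cong (λ xs → + length xs) (filter-++ p? (map (inside ∷_) A) _) ⟩
  + length (filter p? (map (inside ∷_) A) ++ filter p? (map (outside ∷_) A))
    ≡⟨ cong +_ (length-++ (filter p? (map (inside ∷_) A))) ⟩
  + length (filter p? (map (inside ∷_) A)) + + length (filter p? (map (outside ∷_) A))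
    ≡⟨ cong₂ (λ a b → + a + + b) (filter-map inside A) (filter-map outside A) ⟩
  + count (p ∘ (inside ∷_)) + + count (p ∘ (outside ∷_))
    ≡⟨ cong₂ _+_ (count-∑ˢ (p ∘ (inside ∷_))) (count-∑ˢ (p ∘ (outside ∷_))) ⟩
  ∑ˢ (𝟙 ∘ p) ∎
  where
  open ≡-Reasoning
  A = allSubsets n
  p? = λ S → p S Data.Bool.≟ true
  filter-map : ∀ s (xs : List (Subset n)) →
    length (filter p? (map (s ∷_) xs)) ≡ length (filter (λ S → p (s ∷ S) Data.Bool.≟ true) xs)
  filter-map s [] = refl
  filter-map s (S ∷ xs) with p (s ∷ S)
  ... | true  = cong suc (filter-map s xs)
  ... | false = filter-map s xs

-- Splitting on whether the first element belongs to the set gives Pascal's rule.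
∑ˢ-isK : ∀ n k → ∑ˢ {n} (λ S → 𝟙 (isK k S)) ≡ + (n C k)
∑ˢ-isK zero    zero    = refl
∑ˢ-isK zero    (suc k) = refl
∑ˢ-isK (suc n) zero    = cong₂ _+_ (∑ˢ-0 n) (∑ˢ-isK n zero)
∑ˢ-isK (suc n) (suc k) = trans (cong₂ _+_ (∑ˢ-isK n k) (∑ˢ-isK n (suc k)))
  (cong +_ (nCk+nC[k+1]≡[n+1]C[k+1] n k))

-- Embeddings of T_k

does-true : ∀ {P : Set} (d : Dec P) → does d ≡ true → P
does-true (yes p) _ = p

Bool-ext : ∀ {a b} → (a ≡ true → b ≡ true) → (b ≡ true → a ≡ true) → a ≡ b
Bool-ext {true}          f _ = sym (f refl)
Bool-ext {false} {false} _ _ = refl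
Bool-ext {false} {true}  _ g = g refl

∧-split : ∀ {a b} → a ∧ b ≡ true → a ≡ true × b ≡ true
∧-split {true} b≡true = refl , b≡true

∉-delete : ∀ {n} (S : Subset n) x y → y ∈ᵇ delete S x ≡ true → y ≢ x
∉-delete S x .x x∈ refl with () ← trans (sym x∈) (lookup∘updateAt x S)

∈-delete⇒∈ : ∀ {n} (S : Subset n) x y → y ∈ᵇ delete S x ≡ true → y ∈ᵇ S ≡ true
∈-delete⇒∈ S x y y∈ = trans (sym (lookup∘updateAt′ y x (∉-delete S x y y∈) S)) y∈

∈-delete : ∀ {n} (S : Subset n) x y → y ≢ x → y ∈ᵇ S ≡ true → y ∈ᵇ delete S x ≡ true
∈-delete S x y y≢x y∈S = trans (lookup∘updateAt′ y x y≢x S) y∈S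

record Enumerates {m n} (f : Fin m → Fin n) (W : Subset n) : Set where
  field
    injective : Injective _≡_ _≡_ f
    into      : ∀ i → f i ∈ᵇ W ≡ true
    onto      : ∀ w → w ∈ᵇ W ≡ true → ∃ λ i → f i ≡ w
open Enumerates

enumerate : ∀ {n} (W : Subset n) → ∃ λ (f : Fin ∣ W ∣ → Fin n) → Enumerates f W
enumerate [] = (λ ()) , record { injective = λ { {()} } ; into = λ () ; onto = λ () }
enumerate (outside ∷ W) with f , F ← enumerate W = suc ∘ f , record
  { injective = λ eq → injective F (suc-injective eq)
  ; into      = into F
  ; onto      = λ { (suc w) w∈W → let i , eq = onto F w w∈W in i , cong suc eq } }
enumerate {suc n} (inside ∷ W) with f , F ← enumerate W = g , record
  { injective = inj ; into = λ { zero → refl ; (suc i) → into F i }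
  ; onto = λ { zero _ → zero , refl ; (suc w) w∈W → let i , eq = onto F w w∈W in suc i , cong suc eq } }
  where
  g : Fin (suc ∣ W ∣) → Fin (suc n)
  g zero    = zero
  g (suc i) = suc (f i)
  inj : Injective _≡_ _≡_ g
  inj {zero}  {zero}  _  = refl
  inj {suc i} {suc j} eq = cong suc (injective F (suc-injective eq))

-- Precomposing with the transposition of i and the preimage c of w disturbs no index other than i
-- and c, so images fixed earlier survive.
redirect : ∀ {m n} {f : Fin m → Fin n} {W} → Enumerates f W → ∀ i w → w ∈ᵇ W ≡ true →
  ∃ λ g → Enumerates g W × g i ≡ w × (∀ a → a ≢ i → f a ≢ w → g a ≡ f a)
redirect {f = f} {W} F i w w∈W with c , refl ← onto F w w∈W =
  f ∘ transpose i c , record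
    { injective = λ eq → transpose-inj (injective F eq)
    ; into      = into F ∘ transpose i c
    ; onto      = λ u u∈W → let a , eq = onto F u u∈W in
                    transpose c i a , trans (cong f (transpose-inverse i c)) eq }
  , cong f swapped , λ a a≢i fa≢fc → cong f (fixed a a≢i (fa≢fc ∘ cong f))
  where
  transpose-inj : Injective _≡_ _≡_ (transpose i c)
  transpose-inj {a} {b} eq = trans (sym (transpose-inverse c i)) (trans (cong (transpose c i) eq) (transpose-inverse c i))
  swapped : transpose i c i ≡ c
  swapped rewrite dec-true (i Fin.≟ i) refl = refl
  fixed : ∀ a → a ≢ i → a ≢ c → transpose i c a ≡ a
  fixed a a≢i a≢c rewrite dec-false (a Fin.≟ i) a≢i | dec-false (a Fin.≟ c) a≢c = refl

anyFin⁺ : ∀ {m} (p : Fin m → Bool) i → p i ≡ true → anyFin p ≡ true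
anyFin⁺ p zero    pi rewrite pi = refl
anyFin⁺ p (suc i) pi with p zero
... | true  = refl
... | false = anyFin⁺ (p ∘ suc) i pi

anyFin⁻ : ∀ {m} (p : Fin m → Bool) → anyFin p ≡ true → ∃ λ i → p i ≡ true
anyFin⁻ {suc m} p any with p zero in eq
... | true  = zero , eq
... | false = let i , pi = anyFin⁻ (p ∘ suc) any in suc i , pi

-- Each edge of T_k omits exactly one vertex, so it can be described by that vertex alone.
record AllBut {m} (X : Subset m) (c : Fin m) : Set where
  field
    ∈⇒≢ : ∀ i → i ∈ᵇ X ≡ true → i ≢ c
    ≢⇒∈ : ∀ i → i ≢ c → i ∈ᵇ X ≡ true
open AllBut

-- By injectivity f c is the only point of W that is missed. The edges of an embedded T_k thus
-- become sets W minus a point.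
image-AllBut : ∀ {m n} {f : Fin m → Fin n} {W X c} → Enumerates f W → AllBut X c →
  image f X ≡ delete W (f c)
image-AllBut {f = f} {W} {X} {c} F B = trans (tabulate-cong λ j → Bool-ext (to j) (from j)) (tabulate∘lookup _)
  where
  to : ∀ j → anyFin (λ i → lookup X i ∧ does (f i Fin.≟ j)) ≡ true → j ∈ᵇ delete W (f c) ≡ true
  to j any with i , pi ← anyFin⁻ _ any with i∈X , fi≟j ← ∧-split pi with refl ← does-true (f i Fin.≟ j) fi≟j =
    ∈-delete W (f c) (f i) (∈⇒≢ B i i∈X ∘ injective F) (into F i)
  from : ∀ j → j ∈ᵇ delete W (f c) ≡ true → anyFin (λ i → lookup X i ∧ does (f i Fin.≟ j)) ≡ true
  from j j∈ with i , refl ← onto F j (∈-delete⇒∈ W (f c) j j∈) =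
    anyFin⁺ _ i (cong₂ _∧_ (≢⇒∈ B i (∉-delete W (f c) (f i) j∈ ∘ cong f)) (dec-true (f i Fin.≟ f i) refl))

E₁-AllBut : ∀ k → AllBut (E₁ k) (fromℕ k)
E₁-AllBut k = record { ∈⇒≢ = to ; ≢⇒∈ = from }
  where
  to : ∀ i → i ∈ᵇ E₁ k ≡ true → i ≢ fromℕ k
  to i i∈ refl = ℕ.<-irrefl (toℕ-fromℕ k)
    (does-true (toℕ i ℕ.<? k) (trans (sym (lookup∘tabulate (λ a → does (toℕ a ℕ.<? k)) i)) i∈))
  from : ∀ i → i ≢ fromℕ k → i ∈ᵇ E₁ k ≡ true
  from i i≢k = trans (lookup∘tabulate (λ a → does (toℕ a ℕ.<? k)) i) (dec-true (toℕ i ℕ.<? k)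
    (ℕ.≤∧≢⇒< (ℕ.s≤s⁻¹ (toℕ<n i)) λ eq → i≢k (toℕ-injective (trans eq (sym (toℕ-fromℕ k))))))

E₂-AllBut : ∀ k → AllBut (E₂ k) zero
E₂-AllBut k = record { ∈⇒≢ = to ; ≢⇒∈ = from }
  where
  to : ∀ i → i ∈ᵇ E₂ k ≡ true → i ≢ zero
  to i i∈ refl with () ← i∈
  from : ∀ i → i ≢ zero → i ∈ᵇ E₂ k ≡ true
  from zero    i≢0 = contradiction refl i≢0
  from (suc i) _   = lookup∘tabulate _ i

E₃-AllBut : ∀ j → AllBut (E₃ (suc j)) (inject₁ (fromℕ j))
E₃-AllBut j = record { ∈⇒≢ = to ; ≢⇒∈ = from }
  where
  k = suc j
  toℕ-c : toℕ (inject₁ (fromℕ j)) ≡ j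
  toℕ-c = trans (toℕ-inject₁ (fromℕ j)) (toℕ-fromℕ j)
  to : ∀ i → i ∈ᵇ E₃ k ≡ true → i ≢ inject₁ (fromℕ j)
  to i i∈ refl with () ← trans (sym (trans (sym (lookup∘tabulate (e₃ k) i)) i∈))
    (cong₂ _∨_ (dec-false (suc (toℕ i) ℕ.<? k) (λ lt → ℕ.<-irrefl toℕ-c (ℕ.s≤s⁻¹ lt)))
               (dec-false (toℕ i ℕ.≟ k) (λ eq → ℕ.1+n≢n (trans (sym eq) toℕ-c))))
  from : ∀ i → i ≢ inject₁ (fromℕ j) → i ∈ᵇ E₃ k ≡ true
  from i i≢c = trans (lookup∘tabulate (e₃ k) i) (aux (suc (toℕ i) ℕ.<? k))
    where
    aux : (d : Dec (suc (toℕ i) ℕ.< k)) → does d ∨ does (toℕ i ℕ.≟ k) ≡ true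
    aux (yes _) = refl
    aux (no ≮k) = dec-true (toℕ i ℕ.≟ k) (ℕ.≤-antisym (ℕ.s≤s⁻¹ (toℕ<n i))
      (ℕ.≤∧≢⇒< (ℕ.s≤s⁻¹ (ℕ.≮⇒≥ ≮k)) λ eq → i≢c (toℕ-injective (trans (sym eq) (sym toℕ-c)))))

labT-undir : ∀ k S → labT k S ≡ undir → S ≡ E₁ k ⊎ S ≡ E₂ k
labT-undir k S eq with S ≟ˢ E₃ k
labT-undir k S () | yes _
... | no _ with S ≟ˢ E₁ k
...   | yes S≡E₁ = inj₁ S≡E₁
...   | no _ with S ≟ˢ E₂ k
...     | yes S≡E₂ = inj₂ S≡E₂
labT-undir k S () | no _ | no _ | no _

labT-dir : ∀ k S v → labT k S ≡ dir v → S ≡ E₃ k × fromℕ k ≡ v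
labT-dir k S v eq with S ≟ˢ E₃ k
labT-dir k S v refl | yes S≡E₃ = S≡E₃ , refl
... | no _ with does (S ≟ˢ E₁ k) ∨ does (S ≟ˢ E₂ k)
labT-dir k S v () | no _ | true
labT-dir k S v () | no _ | false

-- In the (k+1)-set W, the edges W - v, W - y and W - x take the places of `E₁`, `E₂` and `E₃`.
-- Hence the omitted vertices `top`, 0 and `pen` must go to v, y and x.
embed-T : ∀ {j n} (H : PDG (suc (suc j)) n) (W : Subset n) x v y →
  ∣ W ∣ ≡ suc (suc (suc j)) →
  x ∈ᵇ W ≡ true → v ∈ᵇ W ≡ true → y ∈ᵇ W ≡ true → v ≢ x → y ≢ x → y ≢ v →
  lab H (delete W x) ≡ dir v → lab H (delete W v) ≢ none → lab H (delete W y) ≢ none →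
  T (suc (suc j)) ⊆ᴾ H
embed-T {j} {n} H W x v y ∣W∣ x∈W v∈W y∈W v≢x y≢x y≢v labx labv laby =
  build (subst (λ m → ∃ λ (f : Fin m → Fin n) → Enumerates f W) ∣W∣ (enumerate W))
  where
  k = suc (suc j)
  top pen : Fin (suc k)
  top = fromℕ k
  pen = inject₁ (fromℕ (suc j))
  build : (∃ λ (f : Fin (suc k) → Fin n) → Enumerates f W) → T k ⊆ᴾ H
  build (f₀ , F₀)
    -- Later redirections keep the earlier images because y, v, x are distinct and so are 0, `top`,
    -- `pen`; that 0 differs from `pen` uses k ≥ 2.
    with f₁ , F₁ , f₁0 , _    ← redirect F₀ zero y y∈W
    with f₂ , F₂ , f₂t , f₂≡ ← redirect F₁ top v v∈W
    with f₃ , F₃ , f₃p , f₃≡ ← redirect F₂ pen x x∈W = f₃ , injective F₃ , λ S _ → undirected S , directed S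
    where
    f₂0 : f₂ zero ≡ y
    f₂0 = trans (f₂≡ zero (λ ()) (y≢v ∘ trans (sym f₁0))) f₁0
    f₃0 : f₃ zero ≡ y
    f₃0 = trans (f₃≡ zero (λ ()) (y≢x ∘ trans (sym f₂0))) f₂0
    f₃t : f₃ top ≡ v
    f₃t = trans (f₃≡ top fromℕ≢inject₁ (v≢x ∘ trans (sym f₂t))) f₂t
    undirected : ∀ S → labT k S ≡ undir → lab H (image f₃ S) ≢ none
    undirected S eq with labT-undir k S eq
    ... | inj₁ refl rewrite image-AllBut F₃ (E₁-AllBut k) | f₃t = labv
    ... | inj₂ refl rewrite image-AllBut F₃ (E₂-AllBut k) | f₃0 = laby
    directed : ∀ S u → labT k S ≡ dir u → lab H (image f₃ S) ≡ dir (f₃ u)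
    directed S u eq with refl , refl ← labT-dir k S u eq
      rewrite image-AllBut F₃ (E₃-AllBut (suc j)) | f₃p | f₃t = labx

-- Degrees and (k+1)-sets

*-monoˡ-≤-0≤ : ∀ {a x y} → 0ℤ ℤ.≤ a → x ℤ.≤ y → a * x ℤ.≤ a * y
*-monoˡ-≤-0≤ {a} 0≤a = *-monoˡ-≤-nonNeg a {{nonNegative 0≤a}}

isK-insert : ∀ {n} m (S : Subset n) x → x ∉ᵇ S ≡ true → isK (suc m) (insert S x) ≡ isK m S
isK-insert m S x x∉S = cong (λ a → does (a ℕ.≟ suc m)) (∣insert∣ S x x∉S)

isK-delete : ∀ {n} m (S : Subset n) x → x ∈ᵇ S ≡ true → isK m (delete S x) ≡ isK (suc m) S
isK-delete m S x x∈S = cong (λ a → does (a ℕ.≟ suc m)) (∣delete∣ S x x∈S)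

𝟙-isK-cong : ∀ {n} m (S : Subset n) (f : ℕ → ℤ) → f ∣ S ∣ * 𝟙 (isK m S) ≡ f m * 𝟙 (isK m S)
𝟙-isK-cong m S f with isK m S in eq
... | true  = cong (λ a → f a * 1ℤ) (does-true (∣ S ∣ ℕ.≟ m) eq)
... | false = trans (*-zeroʳ (f ∣ S ∣)) (sym (*-zeroʳ (f m)))

sum-∉≡ : ∀ {n} (S : Subset n) → sum (λ u → 𝟙 (u ∉ᵇ S)) ≡ + n - + ∣ S ∣
sum-∉≡ {n} S = trans (rearrange (sum (λ u → 𝟙 (u ∉ᵇ S))) (+ ∣ S ∣)) (cong (λ a → a - + ∣ S ∣) (sum-∉ S))
  where
  rearrange : ∀ a b → a ≡ (a + b) - b
  rearrange = solve-∀

sum-∉-isK : ∀ {n} m (S : Subset n) c →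
  sum (λ u → 𝟙 (u ∉ᵇ S) * (𝟙 (isK m S) * c)) ≡ (+ n - + m) * (𝟙 (isK m S) * c)
sum-∉-isK {n} m S c = begin
  sum (λ u → 𝟙 (u ∉ᵇ S) * (𝟙 (isK m S) * c))    ≡⟨ *-distribʳ-sum (𝟙 (isK m S) * c) (λ u → 𝟙 (u ∉ᵇ S)) ⟨
  sum (λ u → 𝟙 (u ∉ᵇ S)) * (𝟙 (isK m S) * c)    ≡⟨ cong (_* (𝟙 (isK m S) * c)) (sum-∉≡ S) ⟩
  (+ n - + ∣ S ∣) * (𝟙 (isK m S) * c)             ≡⟨ *-assoc (+ n - + ∣ S ∣) _ c ⟨
  (+ n - + ∣ S ∣) * 𝟙 (isK m S) * c               ≡⟨ cong (_* c) (𝟙-isK-cong m S (λ a → + n - + a)) ⟩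
  (+ n - + m) * 𝟙 (isK m S) * c                   ≡⟨ *-assoc (+ n - + m) _ c ⟩
  (+ n - + m) * (𝟙 (isK m S) * c)                 ∎
  where open ≡-Reasoning

sum-∈-isK : ∀ {n} m (S : Subset n) → sum (λ u → 𝟙 (u ∈ᵇ S) * 𝟙 (isK m S)) ≡ + m * 𝟙 (isK m S)
sum-∈-isK {n} m S = begin
  sum (λ u → 𝟙 (u ∈ᵇ S) * 𝟙 (isK m S))  ≡⟨ *-distribʳ-sum (𝟙 (isK m S)) (λ u → 𝟙 (u ∈ᵇ S)) ⟨
  sum (λ u → 𝟙 (u ∈ᵇ S)) * 𝟙 (isK m S)  ≡⟨ cong (_* 𝟙 (isK m S)) (sum-∈ S) ⟩
  + ∣ S ∣ * 𝟙 (isK m S)                   ≡⟨ 𝟙-isK-cong m S (λ a → + a) ⟩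
  + m * 𝟙 (isK m S)                       ∎
  where open ≡-Reasoning

#sets : ℕ → ℕ → ℤ
#sets n k = ∑ˢ {n} (λ S → 𝟙 (isK k S))

-- Pairs of an m-set inside an (m+1)-set are counted in two ways.
#sets-step : ∀ n m → (+ n - + m) * #sets n m ≡ + suc m * #sets n (suc m)
#sets-step n m = begin
  (+ n - + m) * #sets n m
    ≡⟨ *-distribˡ-∑ˢ {n} (+ n - + m) (λ P → 𝟙 (isK m P)) ⟩
  ∑ˢ {n} (λ P → (+ n - + m) * 𝟙 (isK m P))
    ≡⟨ ∑ˢ-cong (λ P → sym (fold P)) ⟩
  ∑ˢ {n} (λ P → sum λ x → 𝟙 (x ∉ᵇ P) * 𝟙 (isK (suc m) (insert P x)))
    ≡⟨ double-count {n} (λ S _ → 𝟙 (isK (suc m) S)) ⟨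
  ∑ˢ {n} (λ S → sum λ u → 𝟙 (u ∈ᵇ S) * 𝟙 (isK (suc m) S))
    ≡⟨ ∑ˢ-cong {n} (sum-∈-isK (suc m)) ⟩
  ∑ˢ {n} (λ S → + suc m * 𝟙 (isK (suc m) S))
    ≡⟨ *-distribˡ-∑ˢ {n} (+ suc m) (λ S → 𝟙 (isK (suc m) S)) ⟨
  + suc m * #sets n (suc m) ∎
  where
  open ≡-Reasoning
  fold : ∀ P → sum (λ x → 𝟙 (x ∉ᵇ P) * 𝟙 (isK (suc m) (insert P x))) ≡ (+ n - + m) * 𝟙 (isK m P)
  fold P = begin
    sum (λ x → 𝟙 (x ∉ᵇ P) * 𝟙 (isK (suc m) (insert P x)))
      ≡⟨ sum-cong-≗ (λ x → 𝟙*-cong (x ∉ᵇ P) λ x∉P →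
           trans (cong 𝟙 (isK-insert m P x x∉P)) (sym (*-identityʳ _))) ⟩
    sum (λ x → 𝟙 (x ∉ᵇ P) * (𝟙 (isK m P) * 1ℤ))
      ≡⟨ sum-∉-isK m P 1ℤ ⟩
    (+ n - + m) * (𝟙 (isK m P) * 1ℤ)
      ≡⟨ cong ((+ n - + m) *_) (*-identityʳ _) ⟩
    (+ n - + m) * 𝟙 (isK m P) ∎

insert-delete-comm : ∀ {n} (S : Subset n) x v → x ≢ v → insert (delete S v) x ≡ delete (insert S x) v
insert-delete-comm S x v x≢v = sym ([]≔-commutes S x v x≢v)

isEdge : ∀ {n} → Label n → Bool
isEdge none = false
isEdge _    = true

isEdge⇒≢none : ∀ {n} {l : Label n} → isEdge l ≡ true → l ≢ none
isEdge⇒≢none () refl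

module Edges {k n} (H : PDG k n) where

  E : Subset n → Bool
  E S = isK k S ∧ isEdge (lab H S)

  deg : Subset n → ℤ
  deg P = sum (λ x → 𝟙 (x ∉ᵇ P ∧ E (insert P x)))

  towards : Label n → Subset n → Fin n → Bool
  towards (dir v) S x = E (insert (delete S v) x)
  towards _       S x = false

  -- S is directed towards some v, and x can replace v.
  R : Subset n → Fin n → Bool
  R S x = isK k S ∧ towards (lab H S) S x

  B : Subset n → ℤ
  B S = sum (λ x → 𝟙 (x ∉ᵇ S) * 𝟙 (R S x))

  un di : Subset n → ℤ
  un S = 𝟙 (isK k S ∧ isUndir (lab H S))
  di S = 𝟙 (isK k S ∧ isDir (lab H S))

  E≡un+di : ∀ S → 𝟙 (E S) ≡ un S + di S
  E≡un+di S with isK k S | lab H S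
  ... | false | _     = refl
  ... | true  | none  = refl
  ... | true  | undir = refl
  ... | true  | dir _ = refl

  R⇒E : ∀ S x → R S x ≡ true → E S ≡ true
  R⇒E S x RSx with isK k S | lab H S
  R⇒E S x ()  | false | _
  R⇒E S x ()  | true  | none
  R⇒E S x ()  | true  | undir
  R⇒E S x RSx | true  | dir _ = refl

  R⇒dir : ∀ S x → R S x ≡ true → ∃ λ v → ∣ S ∣ ≡ k × lab H S ≡ dir v × E (insert (delete S v) x) ≡ true
  R⇒dir S x RSx = go (lab H S) refl (proj₂ (∧-split {isK k S} RSx))
    where
    go : ∀ l → lab H S ≡ l → towards l S x ≡ true →
      ∃ λ v → ∣ S ∣ ≡ k × lab H S ≡ dir v × E (insert (delete S v) x) ≡ true
    go (dir v) labS Ev = v , does-true (∣ S ∣ ℕ.≟ k) (proj₁ (∧-split {isK k S} RSx)) , labS , Ev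

  E⇒≢none : ∀ S → E S ≡ true → lab H S ≢ none
  E⇒≢none S ES = isEdge⇒≢none (proj₂ (∧-split {isK k S} ES))

  head∈ : ∀ S v → ∣ S ∣ ≡ k → lab H S ≡ dir v → v ∈ᵇ S ≡ true
  head∈ S v ∣S∣ eq = []=⇒lookup (wf H S v ∣S∣ eq)

  -- `R` is false unless S is a directed k-set, so the sum of `B` over all sets only sees directed
  -- edges.
  di*B≡B : ∀ S → di S * B S ≡ B S
  di*B≡B S with isK k S | lab H S
  ... | false | _     = sym (sum-0 (λ x → *-zeroʳ (𝟙 (x ∉ᵇ S))))
  ... | true  | none  = sym (sum-0 (λ x → *-zeroʳ (𝟙 (x ∉ᵇ S))))
  ... | true  | undir = sym (sum-0 (λ x → *-zeroʳ (𝟙 (x ∉ᵇ S))))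
  ... | true  | dir v = *-identityˡ _

  0≤B : ∀ S → 0ℤ ℤ.≤ B S
  0≤B S = 0≤sum λ x → 0≤* (0≤𝟙 (x ∉ᵇ S)) (0≤𝟙 (R S x))

  ∑E≤#sets : ∑ˢ (𝟙 ∘ E) ℤ.≤ #sets n k
  ∑E≤#sets = ∑ˢ-mono λ S → 𝟙-mono {E S} {isK k S} λ ES → proj₁ (∧-split ES)

  deg≤ : ∀ P → deg P ℤ.≤ + n - + ∣ P ∣
  deg≤ P = ≤-trans (sum-mono λ x → 𝟙-mono {x ∉ᵇ P ∧ E (insert P x)} λ h → proj₁ (∧-split h)) (≤-reflexive (sum-∉≡ P))

-- Reciprocal degrees of (k-1)-sets

module Links {j n} (H : PDG (suc j) n) where
  open Edges H

  -- This is estimate (1) multiplied by Q². The reciprocal 1/d(S - u) is replaced by its tangent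
  -- bound, so nothing is divided and the integer t can be chosen separately for each incidence u ∈
  -- S.
  link-bound : ∀ (t : Subset n → Fin n → ℤ) Q →
    ∑ˢ (λ S → sum λ u → 𝟙 (u ∈ᵇ S) * (𝟙 (E S) * (+ 2 * Q * t S u - t S u * t S u * deg (delete S u))))
      ℤ.≤ Q * Q * #sets n j
  link-bound t Q = begin
    ∑ˢ (λ S → sum λ u → 𝟙 (u ∈ᵇ S) * G S u)
      ≡⟨ double-count G ⟩
    ∑ˢ (λ P → sum λ x → 𝟙 (x ∉ᵇ P) * G (insert P x) x)
      ≡⟨ ∑ˢ-cong (λ P → sum-cong-≗ (regroup P)) ⟩
    ∑ˢ (λ P → sum λ x → 𝟙 (w P x) * F P x)
      ≤⟨ ∑ˢ-mono bound ⟩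
    ∑ˢ {n} (λ P → Q * Q * 𝟙 (isK j P))
      ≡⟨ *-distribˡ-∑ˢ {n} (Q * Q) (λ P → 𝟙 (isK j P)) ⟨
    Q * Q * #sets n j ∎
    where
    open ≤-Reasoning
    G F : Subset n → Fin n → ℤ
    G S u = 𝟙 (E S) * (+ 2 * Q * t S u - t S u * t S u * deg (delete S u))
    F P x = + 2 * Q * t (insert P x) x - t (insert P x) x * t (insert P x) x * deg P
    w : Subset n → Fin n → Bool
    w P x = x ∉ᵇ P ∧ E (insert P x)
    regroup : ∀ P x → 𝟙 (x ∉ᵇ P) * G (insert P x) x ≡ 𝟙 (w P x) * F P x
    regroup P x = trans
      (𝟙*-cong (x ∉ᵇ P) λ x∉P → cong (λ S → 𝟙 (E (insert P x)) *
         (+ 2 * Q * t (insert P x) x - t (insert P x) x * t (insert P x) x * deg S)) (delete-insert P x x∉P))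
      (trans (sym (*-assoc (𝟙 (x ∉ᵇ P)) (𝟙 (E (insert P x))) (F P x)))
             (cong (_* F P x) (sym (𝟙-∧ (x ∉ᵇ P) (E (insert P x))))))
    bound : ∀ P → sum (λ x → 𝟙 (w P x) * F P x) ℤ.≤ Q * Q * 𝟙 (isK j P)
    bound P with isK j P in eq
    ... | true  = subst (sum (λ x → 𝟙 (w P x) * F P x) ℤ.≤_) (sym (*-identityʳ (Q * Q)))
                    (selected-tangent-bound (w P) (λ x → t (insert P x) x) Q)
    -- If P does not have size j, no P + x is a k-set and both sides vanish.
    ... | false = ≤-reflexive (trans (sum-0 vanish) (sym (*-zeroʳ (Q * Q))))
      where
      w-false : ∀ x → w P x ≡ false
      w-false x with x ∉ᵇ P in x∉P
      ... | false = refl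
      ... | true  = cong (_∧ isEdge (lab H (insert P x))) (trans (isK-insert j P x x∉P) eq)
      vanish : ∀ x → 𝟙 (w P x) * F P x ≡ 0ℤ
      vanish x = cong (λ b → 𝟙 b * F P x) (w-false x)

-- Consequences of T_k-freeness

module Free {i n} (H : PDG (suc (suc i)) n) (free : H isFreeOf T (suc (suc i))) where
  open Edges H
  j k : ℕ
  j = suc i
  k = suc j

  -- W - x, W - v and W - y would form a copy of T_k, with W - x as its directed edge.
  at-most-two : ∀ W x v y → ∣ W ∣ ≡ suc k → x ∈ᵇ W ≡ true → y ∈ᵇ W ≡ true → y ≢ x → y ≢ v →
    lab H (delete W x) ≡ dir v → E (delete W v) ≡ true → E (delete W y) ≡ true → ⊥
  at-most-two W x v y ∣W∣ x∈W y∈W y≢x y≢v labx Ev Ey = free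
    (embed-T H W x v y ∣W∣ x∈W (∈-delete⇒∈ W x v v∈) y∈W (∉-delete W x v v∈) y≢x y≢v
      labx (E⇒≢none _ Ev) (E⇒≢none _ Ey))
    where
    v∈ : v ∈ᵇ delete W x ≡ true
    v∈ = head∈ (delete W x) v (cong ℕ.pred (trans (∣delete∣ W x x∈W) ∣W∣)) labx

  -- Apply `at-most-two` to W = S + x: the sets W - x, W - v and W - u are S, S - v + x and S - u +
  -- x.
  disjoint : ∀ S v u x → ∣ S ∣ ≡ k → lab H S ≡ dir v → u ∈ᵇ S ≡ true → u ≢ v → x ∉ᵇ S ≡ true →
    E (insert (delete S u) x) ≡ true → E (insert (delete S v) x) ≡ true → ⊥
  disjoint S v u x ∣S∣ labS u∈S u≢v x∉S Eu Ev = at-most-two (insert S x) x v u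
    (trans (∣insert∣ S x x∉S) (cong suc ∣S∣)) (lookup∘updateAt x S)
    (trans (lookup∘updateAt′ u x u≢x S) u∈S) u≢x u≢v
    (trans (cong (lab H) (delete-insert S x x∉S)) labS)
    (subst (λ Z → E Z ≡ true) (insert-delete-comm S x v x≢v) Ev)
    (subst (λ Z → E Z ≡ true) (insert-delete-comm S x u (u≢x ∘ sym)) Eu)
    where
    x∉ : ∀ w → w ∈ᵇ S ≡ true → w ≢ x
    x∉ w w∈S refl with () ← trans (sym w∈S) (not-true x∉S)
    u≢x = x∉ u u∈S
    x≢v = x∉ v (head∈ S v ∣S∣ labS) ∘ sym

  R≡ : ∀ S v x → ∣ S ∣ ≡ k → lab H S ≡ dir v → R S x ≡ E (insert (delete S v) x)
  R≡ S v x ∣S∣ labS =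
    cong₂ (λ b l → b ∧ towards l S x) (dec-true (∣ S ∣ ℕ.≟ k) ∣S∣) labS

  -- A point completing S - v to an edge is either v or a point outside S that `B` counts.
  deg-head : ∀ S v → ∣ S ∣ ≡ k → lab H S ≡ dir v → deg (delete S v) ℤ.≤ 1ℤ + B S
  deg-head S v ∣S∣ labS = begin
    deg (delete S v)                                     ≤⟨ sum-mono pointwise ⟩
    sum (λ x → δ x + 𝟙 (x ∉ᵇ S) * 𝟙 (R S x))             ≡⟨ ∑-distrib-+ δ (λ x → 𝟙 (x ∉ᵇ S) * 𝟙 (R S x)) ⟩
    sum δ + B S                                          ≡⟨ cong (λ a → a + B S) (sum-δ v) ⟩
    1ℤ + B S                                             ∎
    where
    open ≤-Reasoning
    δ : Fin n → ℤ
    δ x = 𝟙 (does (x Fin.≟ v))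
    pointwise : ∀ x → 𝟙 (x ∉ᵇ delete S v ∧ E (insert (delete S v) x)) ℤ.≤ δ x + 𝟙 (x ∉ᵇ S) * 𝟙 (R S x)
    pointwise x with x Fin.≟ v
    ... | yes _ = ≤-trans (𝟙≤1 (x ∉ᵇ delete S v ∧ E (insert (delete S v) x)))
      (+-monoʳ-≤ 1ℤ (0≤* (0≤𝟙 (x ∉ᵇ S)) (0≤𝟙 (R S x))))
    ... | no x≢v rewrite lookup∘updateAt′ x v {f = λ _ → outside} x≢v S | R≡ S v x ∣S∣ labS =
      ≤-reflexive (trans (𝟙-∧ (x ∉ᵇ S) _) (sym (+-identityˡ _)))

  -- Besides u, only the n - k points outside S can complete S - u, and by `disjoint` none of these
  -- is also counted by `B`. With u included this gives n - k + 1 = n - j.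
  deg-tail : ∀ S v u → ∣ S ∣ ≡ k → lab H S ≡ dir v → u ∈ᵇ S ≡ true → u ≢ v →
    deg (delete S u) + B S ℤ.≤ + n - + j
  deg-tail S v u ∣S∣ labS u∈S u≢v = begin
    deg (delete S u) + B S                  ≡⟨ ∑-distrib-+ a b ⟨
    sum (λ x → a x + b x)                   ≤⟨ sum-mono pointwise ⟩
    sum (λ x → δ x + 𝟙 (x ∉ᵇ S))            ≡⟨ ∑-distrib-+ δ (λ x → 𝟙 (x ∉ᵇ S)) ⟩
    sum δ + sum (λ x → 𝟙 (x ∉ᵇ S))          ≡⟨ cong₂ _+_ (sum-δ u) (sum-∉≡ S) ⟩
    1ℤ + (+ n - + ∣ S ∣)                    ≡⟨ cong (λ m → 1ℤ + (+ n - + m)) ∣S∣ ⟩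
    1ℤ + (+ n - (1ℤ + + j))                 ≡⟨ shift (+ n) (+ j) ⟩
    + n - + j                               ∎
    where
    open ≤-Reasoning
    shift : ∀ a b → 1ℤ + (a - (1ℤ + b)) ≡ a - b
    shift = solve-∀
    a b δ : Fin n → ℤ
    a x = 𝟙 (x ∉ᵇ delete S u ∧ E (insert (delete S u) x))
    b x = 𝟙 (x ∉ᵇ S) * 𝟙 (R S x)
    δ x = 𝟙 (does (x Fin.≟ u))
    pointwise : ∀ x → a x + b x ℤ.≤ δ x + 𝟙 (x ∉ᵇ S)
    pointwise x with x Fin.≟ u
    ... | yes refl rewrite u∈S =
      +-mono-≤ (𝟙≤1 (u ∉ᵇ delete S u ∧ E (insert (delete S u) u))) (≤-refl {0ℤ})
    ... | no x≢u rewrite lookup∘updateAt′ x u {f = λ _ → outside} x≢u S | R≡ S v x ∣S∣ labS with x ∉ᵇ S in x∉S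
    ...   | false = ≤-refl
    ...   | true with E (insert (delete S u) x) in Eu | E (insert (delete S v) x) in Ev
    ...     | false | false = +≤+ ℕ.z≤n
    ...     | false | true  = ≤-refl
    ...     | true  | false = ≤-refl
    ...     | true  | true  = ⊥-elim (disjoint S v u x ∣S∣ labS u∈S u≢v x∉S Eu Ev)

  -- The weights j and 2 make both cases tight. If no deletion from W satisfies `R`, there are at
  -- most k + 1 edges, giving 2(k + 1). Otherwise W has at most two edges and both sums are at most
  -- 2, giving 2j + 4 = 2(k + 1).
  local : ∀ W → + j * sum (λ x → 𝟙 (x ∈ᵇ W) * 𝟙 (R (delete W x) x))
              + + 2 * sum (λ x → 𝟙 (x ∈ᵇ W) * 𝟙 (E (delete W x)))
            ℤ.≤ + 2 * + suc k * 𝟙 (isK (suc k) W)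
  local W with isK (suc k) W in isKW
  ... | false = ≤-reflexive (trans
      (cong₂ (λ a b → + j * a + + 2 * b)
        (sum-0 λ x → vanish x (towards (lab H (delete W x)) (delete W x) x))
        (sum-0 λ x → vanish x (isEdge (lab H (delete W x)))))
      (zeros (+ j) (+ suc k)))
    where
    zeros : ∀ a b → a * 0ℤ + + 2 * 0ℤ ≡ + 2 * b * 0ℤ
    zeros = solve-∀
    vanish : ∀ x c → 𝟙 (x ∈ᵇ W) * 𝟙 (isK k (delete W x) ∧ c) ≡ 0ℤ
    vanish x c with x ∈ᵇ W in x∈W
    ... | false = refl
    ... | true  = cong (λ b → 1ℤ * 𝟙 (b ∧ c)) (trans (isK-delete k W x x∈W) isKW)
  ... | true with ∣W∣ ← does-true (∣ W ∣ ℕ.≟ suc k) isKW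
             with any? (λ x → (x ∈ᵇ W ∧ R (delete W x) x) Data.Bool.≟ true)
  ...   | no none-R = begin
    + j * sum q + + 2 * sum t  ≡⟨ cong (λ a → + j * a + + 2 * sum t) (sum-0 q≡0) ⟩
    + j * 0ℤ + + 2 * sum t     ≡⟨ cong (λ a → a + + 2 * sum t) (*-zeroʳ (+ j)) ⟩
    0ℤ + + 2 * sum t           ≡⟨ +-identityˡ _ ⟩
    + 2 * sum t                ≤⟨ *-monoˡ-≤-nonNeg (+ 2) t≤ ⟩
    + 2 * + suc k              ≡⟨ *-identityʳ _ ⟨
    + 2 * + suc k * 1ℤ         ∎
    where
    open ≤-Reasoning
    q t : Fin n → ℤ
    q x = 𝟙 (x ∈ᵇ W) * 𝟙 (R (delete W x) x)
    t x = 𝟙 (x ∈ᵇ W) * 𝟙 (E (delete W x))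
    q≡0 : ∀ x → q x ≡ 0ℤ
    q≡0 x with x ∈ᵇ W ∧ R (delete W x) x in eq | 𝟙-∧ (x ∈ᵇ W) (R (delete W x) x)
    ... | true  | _    = contradiction (x , eq) none-R
    ... | false | 0≡q = sym 0≡q
    t≤ : sum t ℤ.≤ + suc k
    t≤ = ≤-trans (sum-mono λ x → ≤-trans (≤-reflexive (sym (𝟙-∧ (x ∈ᵇ W) (E (delete W x)))))
                   (𝟙-mono {x ∈ᵇ W ∧ E (delete W x)} λ h → proj₁ (∧-split h)))
                 (≤-reflexive (trans (sum-∈ W) (cong (λ a → + a) ∣W∣)))
  ...   | yes (x₀ , h) with x₀∈W , Rx₀ ← ∧-split {x₀ ∈ᵇ W} h
                       with v , ∣S∣ , labS , Ev ← R⇒dir (delete W x₀) x₀ Rx₀ = begin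
    + j * sum q + + 2 * sum t  ≤⟨ +-monoˡ-≤ (+ 2 * sum t) (*-monoˡ-≤-nonNeg (+ j) (sum-mono q≤t)) ⟩
    + j * sum t + + 2 * sum t  ≡⟨ *-distribʳ-+ (sum t) (+ j) (+ 2) ⟨
    (+ j + + 2) * sum t        ≤⟨ *-monoˡ-≤-nonNeg (+ j + + 2) t≤2 ⟩
    (+ j + + 2) * + 2          ≡⟨ final (+ j) ⟩
    + 2 * + suc k * 1ℤ         ∎
    where
    open ≤-Reasoning
    final : ∀ a → (a + + 2) * + 2 ≡ + 2 * (+ 2 + a) * 1ℤ
    final = solve-∀
    q t δ : Fin n → ℤ
    q x = 𝟙 (x ∈ᵇ W) * 𝟙 (R (delete W x) x)
    t x = 𝟙 (x ∈ᵇ W) * 𝟙 (E (delete W x))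
    -- Only the deletion of x₀ or of v can leave an edge.
    δ x = 𝟙 (does (x Fin.≟ x₀)) + 𝟙 (does (x Fin.≟ v))
    q≤t : ∀ x → q x ℤ.≤ t x
    q≤t x = 𝟙*-mono (x ∈ᵇ W) λ _ → 𝟙-mono (R⇒E (delete W x) x)
    v≢x₀ : v ≢ x₀
    v≢x₀ = ∉-delete W x₀ v (head∈ (delete W x₀) v ∣S∣ labS)
    EWv : E (delete W v) ≡ true
    EWv = subst (λ Z → E Z ≡ true)
      (trans (insert-delete-comm (delete W x₀) x₀ v (v≢x₀ ∘ sym)) (cong (λ Z → delete Z v) (insert-delete W x₀ x₀∈W))) Ev
    t≤1 : ∀ y → t y ℤ.≤ 1ℤ
    t≤1 y = ≤-trans (≤-reflexive (sym (𝟙-∧ (y ∈ᵇ W) (E (delete W y))))) (𝟙≤1 (y ∈ᵇ W ∧ E (delete W y)))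
    t≤δ : ∀ y → t y ℤ.≤ δ y
    t≤δ y with y Fin.≟ x₀ | y Fin.≟ v
    ... | yes _ | d     = ≤-trans (t≤1 y) (+-monoʳ-≤ 1ℤ (0≤𝟙 (does d)))
    ... | no _  | yes _ = t≤1 y
    ... | no y≢x₀ | no y≢v with y ∈ᵇ W in y∈W | E (delete W y) in Ey
    ...   | false | _     = ≤-refl
    ...   | true  | false = ≤-refl
    ...   | true  | true  = ⊥-elim (at-most-two W x₀ v y ∣W∣ x₀∈W y∈W y≢x₀ y≢v labS EWv Ey)
    t≤2 : sum t ℤ.≤ + 2
    t≤2 = ≤-trans (sum-mono t≤δ) (≤-reflexive (trans
      (∑-distrib-+ (λ x → 𝟙 (does (x Fin.≟ x₀))) (λ x → 𝟙 (does (x Fin.≟ v))))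
      (cong₂ _+_ (sum-δ x₀) (sum-δ v))))

  -- This is estimate (2): `local` summed over all W. A pair x ∉ S becomes W = S + x with x marked,
  -- and each edge lies in n - k of the (k+1)-sets.
  ∑B-bound : + j * ∑ˢ B + + 2 * ((+ n - + k) * ∑ˢ (𝟙 ∘ E)) ℤ.≤ + 2 * ((+ n - + k) * #sets n k)
  ∑B-bound = begin
    + j * ∑ˢ B + + 2 * ((+ n - + k) * ∑ˢ (𝟙 ∘ E))
      ≡⟨ cong₂ (λ a b → + j * a + + 2 * b) (double-count′ (λ S x → 𝟙 (R S x))) edges ⟩
    + j * ∑ˢ Q + + 2 * ∑ˢ t
      ≡⟨ cong₂ _+_ (*-distribˡ-∑ˢ (+ j) Q) (*-distribˡ-∑ˢ (+ 2) t) ⟩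
    ∑ˢ (λ W → + j * Q W) + ∑ˢ (λ W → + 2 * t W)
      ≡⟨ ∑ˢ-distrib-+ (λ W → + j * Q W) (λ W → + 2 * t W) ⟨
    ∑ˢ (λ W → + j * Q W + + 2 * t W)
      ≤⟨ ∑ˢ-mono local ⟩
    ∑ˢ {n} (λ W → + 2 * + suc k * 𝟙 (isK (suc k) W))
      ≡⟨ *-distribˡ-∑ˢ {n} (+ 2 * + suc k) (λ W → 𝟙 (isK (suc k) W)) ⟨
    + 2 * + suc k * #sets n (suc k)
      ≡⟨ *-assoc (+ 2) (+ suc k) _ ⟩
    + 2 * (+ suc k * #sets n (suc k))
      ≡⟨ cong (+ 2 *_) (#sets-step n k) ⟨
    + 2 * ((+ n - + k) * #sets n k) ∎
    where
    open ≤-Reasoning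
    Q t : Subset n → ℤ
    Q W = sum (λ x → 𝟙 (x ∈ᵇ W) * 𝟙 (R (delete W x) x))
    t W = sum (λ x → 𝟙 (x ∈ᵇ W) * 𝟙 (E (delete W x)))
    edges : (+ n - + k) * ∑ˢ (𝟙 ∘ E) ≡ ∑ˢ t
    edges = trans (*-distribˡ-∑ˢ (+ n - + k) (𝟙 ∘ E)) (trans (∑ˢ-cong perS) (double-count′ (λ S _ → 𝟙 (E S))))
      where
      perS : ∀ S → (+ n - + k) * 𝟙 (E S) ≡ sum (λ x → 𝟙 (x ∉ᵇ S) * 𝟙 (E S))
      perS S rewrite 𝟙-∧ (isK k S) (isEdge (lab H S)) = sym (sum-∉-isK k S (𝟙 (isEdge (lab H S))))

-- The weighted edge bound

0≤+n : ∀ {n} → 0ℤ ℤ.≤ + n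
0≤+n = +≤+ ℕ.z≤n

-- The tangent bound decreases in the degree, so an upper bound on a degree may replace it.
tangent-antitone : ∀ a c {x y} → x ℤ.≤ y → a - c * c * y ℤ.≤ a - c * c * x
tangent-antitone a c x≤y = +-monoʳ-≤ a (neg-mono-≤ (*-monoˡ-≤-0≤ (0≤x*x c) x≤y))

0<* : ∀ {x y} → 0ℤ < x → 0ℤ < y → 0ℤ < x * y
0<* {+ suc m} {+ suc n} _ _ = +<+ (ℕ.s≤s ℕ.z≤n)
0<* {+ zero} (+<+ ())
0<* {+ suc m} {+ zero} _ (+<+ ())

-- With Q = L M, `α` and `β` are the tangent bounds at a tail of degree at most M - b and at a head
-- of degree at most 1 + b. A parameter t touches at degree Q / t, so σ / L = k / (k - 1) touches at
-- b = M / k.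
module Weights (M L σ τ : ℤ) where
  α β : ℤ → ℤ
  α b = + 2 * (L * M) * σ - σ * σ * (M - b)
  β b = + 2 * (L * M) * τ - τ * τ * (1ℤ + b)

cubic-nonneg : ∀ a b c d x → 0ℤ ℤ.≤ a → 0ℤ ℤ.≤ b → 0ℤ ℤ.≤ c → 0ℤ ℤ.≤ d → 0ℤ ℤ.≤ x →
  0ℤ ℤ.≤ a * x * x * x + b * x * x + c * x + d
cubic-nonneg a b c d x 0≤a 0≤b 0≤c 0≤d 0≤x =
  0≤+ (0≤+ (0≤+ (0≤* (0≤* (0≤* 0≤a 0≤x) 0≤x) 0≤x) (0≤* (0≤* 0≤b 0≤x) 0≤x)) (0≤* 0≤c 0≤x)) 0≤d

-- With σ / L = k / (k − 1) and τ / L close to 3k / 5, both the coefficient of b and the constant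
-- term of the difference are nonnegative.
gain : ∀ I J K M R b → J ≡ 1ℤ + I → K ≡ 1ℤ + J → M ≡ + 200 * J + R → 0ℤ ℤ.≤ I → 0ℤ ℤ.≤ R → 0ℤ ℤ.≤ b →
  let open Weights M (+ 10 * J) (+ 10 * K) (K * (+ 6 * J + + 5)) in
  + 3700 * J * J * K * M ℤ.≤ + 17 * (J * α b + β b + + 50 * J * J * J * K * b)
-- Expanding in I = J - 1 and R = M - 200 J leaves only nonnegative coefficients; in powers of J
-- some are negative.
gain I J K M R b refl refl refl 0≤I 0≤R 0≤b = 0≤i-j⇒j≤i (subst (0ℤ ℤ.≤_) (sym (identity I R b))
  (assemble K (+ 17) (+ 14 * I * I * I + + 46 * I * I + + 65 * I + + 8) b (+ 40) J R _ 0≤K 0≤+n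
    (cubic-nonneg (+ 14) (+ 46) (+ 65) (+ 8) I 0≤+n 0≤+n 0≤+n 0≤+n 0≤I) 0≤b 0≤+n 0≤J 0≤R
    (cubic-nonneg (+ 7388) (+ 20532) (+ 17455) (+ 3886) I 0≤+n 0≤+n 0≤+n 0≤+n 0≤I)))
  where
  0≤J : 0ℤ ℤ.≤ J
  0≤J = 0≤+ {1ℤ} 0≤+n 0≤I
  0≤K : 0ℤ ℤ.≤ K
  0≤K = 0≤+ {1ℤ} 0≤+n 0≤J
  assemble : ∀ k e p b f j r q → 0ℤ ℤ.≤ k → 0ℤ ℤ.≤ e →
    0ℤ ℤ.≤ p → 0ℤ ℤ.≤ b → 0ℤ ℤ.≤ f → 0ℤ ℤ.≤ j → 0ℤ ℤ.≤ r → 0ℤ ℤ.≤ q →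
    0ℤ ℤ.≤ k * (e * p * b + f * j * j * r + q)
  assemble k e p b f j r q 0≤k 0≤e 0≤p 0≤b 0≤f 0≤j 0≤r 0≤q =
    0≤* 0≤k (0≤+ (0≤+ (0≤* (0≤* 0≤e 0≤p) 0≤b) (0≤* (0≤* (0≤* 0≤f 0≤j) 0≤j) 0≤r)) 0≤q)
  -- The `+ 5` in τ cancels the lower-order part of the M terms, which then exceed 3700 J² K M by
  -- exactly 40 J² K M. Since M ≥ 200 J, this outweighs 17 τ².
  identity : ∀ I R b →
    let J = 1ℤ + I ; K = 1ℤ + J ; M = + 200 * J + R ; L = + 10 * J ; σ = + 10 * K ; τ = K * (+ 6 * J + + 5) in
    + 17 * (J * (+ 2 * (L * M) * σ - σ * σ * (M - b)) + (+ 2 * (L * M) * τ - τ * τ * (1ℤ + b))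
            + + 50 * J * J * J * K * b)
      - + 3700 * J * J * K * M
     ≡ K * (+ 17 * (+ 14 * I * I * I + + 46 * I * I + + 65 * I + + 8) * b
            + + 40 * J * J * R
            + (+ 7388 * I * I * I + + 20532 * I * I + + 17455 * I + + 3886))
  identity = solve-∀

-- Add 17 times the link estimate, 850 J² K times the local one, the gain, and 1700 J² K times U + D
-- ≤ N. The terms X and B cancel, and the last multiple turns M - 1 into M. What remains is 200 J² K
-- M times the claim: 200·17 = 1700 + 1700 and 200·27 = 3700 + 1700.
combine : ∀ J K M N′ N U D X B → 0ℤ < J → 0ℤ < K → 0ℤ < M → M * N′ ≡ K * N →
  let L = + 10 * J in
  K * (L * L * M) * U + X ℤ.≤ L * M * (L * M) * N′ →
  J * B + + 2 * ((M - 1ℤ) * (U + D)) ℤ.≤ + 2 * ((M - 1ℤ) * N) →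
  U + D ℤ.≤ N →
  + 3700 * J * J * K * M * D ℤ.≤ + 17 * (X + + 50 * J * J * J * K * B) →
  + 17 * U + + 27 * D ℤ.≤ + 17 * N
combine J K M N′ N U D X B 0<J 0<K 0<M MN′ link local U+D≤N gain = cancel (+ 200) (+<+ (ℕ.s≤s ℕ.z≤n))
  (0≤i-j⇒j≤i (subst (0ℤ ℤ.≤_) (sym (identity J K M N U D X B))
    (assemble (+ 17) (+ 850) (+ 1700) 0≤+n 0≤+n 0≤+n
      (i≤j⇒0≤j-i link′) (i≤j⇒0≤j-i local) (i≤j⇒0≤j-i gain) (i≤j⇒0≤j-i U+D≤N))))
  where
  cancel : ∀ a {x y} → 0ℤ < a → a * J * J * K * M * x ℤ.≤ a * J * J * K * M * y → x ℤ.≤ y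
  cancel a {x} {y} 0<a = *-cancelˡ-≤-pos x y (a * J * J * K * M)
    {{positive (0<* (0<* (0<* (0<* 0<a 0<J) 0<J) 0<K) 0<M)}}
  assemble : ∀ a b c {w x y z} → 0ℤ ℤ.≤ a → 0ℤ ℤ.≤ b → 0ℤ ℤ.≤ c → 0ℤ ℤ.≤ w → 0ℤ ℤ.≤ x → 0ℤ ℤ.≤ y → 0ℤ ℤ.≤ z →
    0ℤ ℤ.≤ a * w + b * J * J * K * x + y + c * J * J * K * z
  assemble a b c 0≤a 0≤b 0≤c 0≤w 0≤x 0≤y 0≤z =
    0≤+ (0≤+ (0≤+ (0≤* 0≤a 0≤w) (0≤* (0≤JJK 0≤b) 0≤x)) 0≤y) (0≤* (0≤JJK 0≤c) 0≤z)
    where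
    0≤JJK : ∀ {e} → 0ℤ ℤ.≤ e → 0ℤ ℤ.≤ e * J * J * K
    0≤JJK 0≤e = 0≤* (0≤* (0≤* 0≤e (<⇒≤ 0<J)) (<⇒≤ 0<J)) (<⇒≤ 0<K)
  regroup : ∀ L M N′ → L * M * (L * M) * N′ ≡ L * L * M * (M * N′)
  regroup = solve-∀
  link′ : K * (+ 10 * J * (+ 10 * J) * M) * U + X ℤ.≤ + 10 * J * (+ 10 * J) * M * (K * N)
  link′ = ≤-trans link (≤-reflexive (trans (regroup (+ 10 * J) M N′) (cong (+ 10 * J * (+ 10 * J) * M *_) MN′)))
  identity : ∀ J K M N U D X B →
    + 200 * J * J * K * M * (+ 17 * N) - + 200 * J * J * K * M * (+ 17 * U + + 27 * D) ≡
      + 17 * (+ 10 * J * (+ 10 * J) * M * (K * N) - (K * (+ 10 * J * (+ 10 * J) * M) * U + X))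
      + + 850 * J * J * K * (+ 2 * ((M - 1ℤ) * N) - (J * B + + 2 * ((M - 1ℤ) * (U + D))))
      + (+ 17 * (X + + 50 * J * J * J * K * B) - + 3700 * J * J * K * M * D)
      + + 1700 * J * J * K * (N - (U + D))
  identity = solve-∀

-- Weighted totals over all edges

module Bound {i n} (H : PDG (suc (suc i)) n) (free : H isFreeOf T (suc (suc i))) (L σ τ : ℤ) where
  open Edges H
  open Links H
  open Free H free

  J K M : ℤ
  J = + j
  K = + k
  M = + n - + j

  open Weights M L σ τ

  -- The parameter t fed to `link-bound`: each kind of incidence has its own point of tangency.
  weight : Label n → Fin n → ℤ
  weight (dir v) u = if does (u Fin.≟ v) then τ else σ
  weight _       u = L

  value : Subset n → Fin n → ℤ
  value S u = + 2 * (L * M) * weight (lab H S) u - weight (lab H S) u * weight (lab H S) u * deg (delete S u)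

  -- All k degrees are at most M, the degree at which the parameter `L` is tangent, so each
  -- incidence contributes at least L² M.
  value-undirected : ∀ S → ∣ S ∣ ≡ k → lab H S ≡ undir →
    K * (L * L * M) ℤ.≤ sum (λ u → 𝟙 (u ∈ᵇ S) * value S u)
  value-undirected S ∣S∣ labS rewrite labS = begin
    K * (L * L * M)                              ≡⟨ cong (λ m → + m * (L * L * M)) ∣S∣ ⟨
    + ∣ S ∣ * (L * L * M)                        ≡⟨ cong (_* (L * L * M)) (sum-∈ S) ⟨
    sum (λ u → 𝟙 (u ∈ᵇ S)) * (L * L * M)         ≡⟨ *-distribʳ-sum (L * L * M) (λ u → 𝟙 (u ∈ᵇ S)) ⟩
    sum (λ u → 𝟙 (u ∈ᵇ S) * (L * L * M))         ≤⟨ sum-mono (λ u → 𝟙*-mono (u ∈ᵇ S) (pointwise u)) ⟩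
    sum (λ u → 𝟙 (u ∈ᵇ S) * (+ 2 * (L * M) * L - L * L * deg (delete S u))) ∎
    where
    open ≤-Reasoning
    tangent : ∀ L M → L * L * M ≡ + 2 * (L * M) * L - L * L * M
    tangent = solve-∀
    deg≤M : ∀ u → u ∈ᵇ S ≡ true → deg (delete S u) ℤ.≤ M
    deg≤M u u∈S = ≤-trans (deg≤ (delete S u)) (≤-reflexive
      (cong (λ m → + n - + m) (cong ℕ.pred (trans (∣delete∣ S u u∈S) ∣S∣))))
    pointwise : ∀ u → u ∈ᵇ S ≡ true → L * L * M ℤ.≤ + 2 * (L * M) * L - L * L * deg (delete S u)
    pointwise u u∈S = ≤-trans (≤-reflexive (tangent L M)) (tangent-antitone (+ 2 * (L * M) * L) L (deg≤M u u∈S))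

  value-directed : ∀ S v → ∣ S ∣ ≡ k → lab H S ≡ dir v →
    J * α (B S) + β (B S) ℤ.≤ sum (λ u → 𝟙 (u ∈ᵇ S) * value S u)
  value-directed S v ∣S∣ labS = begin
    -- The k - 1 tails and one head are recast as a for every element of S plus a correction b - a
    -- at v, which fits a single sum over u.
    J * a + b                                              ≡⟨ split J a b ⟩
    K * a + 1ℤ * (b - a)                                   ≡⟨ cong₂ (λ x y → x * a + y * (b - a)) K≡ (sym (sum-δ v)) ⟩
    sum (λ u → 𝟙 (u ∈ᵇ S)) * a + sum δ * (b - a)
      ≡⟨ cong₂ _+_ (*-distribʳ-sum a (λ u → 𝟙 (u ∈ᵇ S))) (*-distribʳ-sum (b - a) δ) ⟩
    sum (λ u → 𝟙 (u ∈ᵇ S) * a) + sum (λ u → δ u * (b - a))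
      ≡⟨ ∑-distrib-+ (λ u → 𝟙 (u ∈ᵇ S) * a) (λ u → δ u * (b - a)) ⟨
    sum (λ u → 𝟙 (u ∈ᵇ S) * a + δ u * (b - a))             ≤⟨ sum-mono pointwise ⟩
    sum (λ u → 𝟙 (u ∈ᵇ S) * value S u)                     ∎
    where
    open ≤-Reasoning
    a b : ℤ
    a = α (B S)
    b = β (B S)
    δ : Fin n → ℤ
    δ u = 𝟙 (does (u Fin.≟ v))
    K≡ : K ≡ sum (λ u → 𝟙 (u ∈ᵇ S))
    K≡ = trans (cong (λ m → + m) (sym ∣S∣)) (sym (sum-∈ S))
    split : ∀ J a b → J * a + b ≡ (1ℤ + J) * a + 1ℤ * (b - a)
    split = solve-∀
    head-sum : ∀ a b → 1ℤ * a + 1ℤ * (b - a) ≡ 1ℤ * b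
    head-sum = solve-∀
    move : ∀ x y → x ≡ (x + y) - y
    move = solve-∀
    value≡ : ∀ u → value S u ≡
      + 2 * (L * M) * weight (dir v) u - weight (dir v) u * weight (dir v) u * deg (delete S u)
    value≡ u = cong (λ l → + 2 * (L * M) * weight l u - weight l u * weight l u * deg (delete S u)) labS
    deg≤M-B : ∀ u → u ∈ᵇ S ≡ true → u ≢ v → deg (delete S u) ℤ.≤ M - B S
    deg≤M-B u u∈S u≢v = ≤-trans (≤-reflexive (move (deg (delete S u)) (B S)))
      (+-monoˡ-≤ (- B S) (deg-tail S v u ∣S∣ labS u∈S u≢v))
    pointwise : ∀ u → 𝟙 (u ∈ᵇ S) * a + δ u * (b - a) ℤ.≤ 𝟙 (u ∈ᵇ S) * value S u
    pointwise u rewrite value≡ u with u Fin.≟ v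
    ... | yes refl rewrite head∈ S v ∣S∣ labS = ≤-trans (≤-reflexive (head-sum a b))
      (*-monoˡ-≤-nonNeg 1ℤ (tangent-antitone (+ 2 * (L * M) * τ) τ (deg-head S v ∣S∣ labS)))
    ... | no u≢v = ≤-trans (≤-reflexive (+-identityʳ (𝟙 (u ∈ᵇ S) * a)))
      (𝟙*-mono (u ∈ᵇ S) λ u∈S → tangent-antitone (+ 2 * (L * M) * σ) σ (deg≤M-B u u∈S u≢v))

  edge-value : ∀ S → un S * (K * (L * L * M)) + di S * (J * α (B S) + β (B S))
    ℤ.≤ sum (λ u → 𝟙 (u ∈ᵇ S) * (𝟙 (E S) * value S u))
  edge-value S = cases (isK k S) (lab H S) refl refl
    where
    b = J * α (B S) + β (B S)
    a = K * (L * L * M)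
    cases : ∀ c l → isK k S ≡ c → lab H S ≡ l →
      𝟙 (c ∧ isUndir l) * a + 𝟙 (c ∧ isDir l) * b ℤ.≤ sum (λ u → 𝟙 (u ∈ᵇ S) * (𝟙 (c ∧ isEdge l) * value S u))
    cases false l     _ _ = ≤-reflexive (sym (sum-0 λ u → *-zeroʳ (𝟙 (u ∈ᵇ S))))
    cases true  none  _ _ = ≤-reflexive (sym (sum-0 λ u → *-zeroʳ (𝟙 (u ∈ᵇ S))))
    cases true  undir isKS labS = ≤-trans
      (≤-reflexive (trans (+-identityʳ (1ℤ * a)) (*-identityˡ a)))
      (≤-trans (value-undirected S (does-true (∣ S ∣ ℕ.≟ k) isKS) labS)
               (≤-reflexive (sum-cong-≗ λ u → cong (𝟙 (u ∈ᵇ S) *_) (sym (*-identityˡ (value S u))))))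
    cases true (dir v) isKS labS = ≤-trans
      (≤-reflexive (trans (+-identityˡ (1ℤ * b)) (*-identityˡ b)))
      (≤-trans (value-directed S v (does-true (∣ S ∣ ℕ.≟ k) isKS) labS)
               (≤-reflexive (sum-cong-≗ λ u → cong (𝟙 (u ∈ᵇ S) *_) (sym (*-identityˡ (value S u))))))

  X : ℤ
  X = ∑ˢ (λ S → di S * (J * α (B S) + β (B S)))

  link-total : K * (L * L * M) * ∑ˢ un + X ℤ.≤ L * M * (L * M) * #sets n j
  link-total = begin
    K * (L * L * M) * ∑ˢ un + X
      ≡⟨ cong (λ a → a + X) (trans (*-distribˡ-∑ˢ (K * (L * L * M)) un)
           (∑ˢ-cong λ S → *-comm (K * (L * L * M)) (un S))) ⟩
    ∑ˢ (λ S → un S * (K * (L * L * M))) + X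
      ≡⟨ ∑ˢ-distrib-+ (λ S → un S * (K * (L * L * M))) (λ S → di S * (J * α (B S) + β (B S))) ⟨
    ∑ˢ (λ S → un S * (K * (L * L * M)) + di S * (J * α (B S) + β (B S)))
      ≤⟨ ∑ˢ-mono edge-value ⟩
    ∑ˢ (λ S → sum (λ u → 𝟙 (u ∈ᵇ S) * (𝟙 (E S) * value S u)))
      ≤⟨ link-bound (λ S → weight (lab H S)) (L * M) ⟩
    L * M * (L * M) * #sets n j ∎
    where open ≤-Reasoning

  -- The inequality at b = B(S) is summed over directed edges; `di*B≡B` then extends the `B` term to
  -- all sets.
  gain-total : ∀ c d e → (∀ b → 0ℤ ℤ.≤ b → c ℤ.≤ e * (J * α b + β b + d * b)) →
    c * ∑ˢ di ℤ.≤ e * (X + d * ∑ˢ B)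
  gain-total c d e c≤ = begin
    c * ∑ˢ di                                ≡⟨ *-distribˡ-∑ˢ c di ⟩
    ∑ˢ (λ S → c * di S)                      ≤⟨ ∑ˢ-mono pointwise ⟩
    ∑ˢ (λ S → e * (x S + d * B S))           ≡⟨ *-distribˡ-∑ˢ e (λ S → x S + d * B S) ⟨
    e * ∑ˢ (λ S → x S + d * B S)             ≡⟨ cong (e *_) (∑ˢ-distrib-+ x (λ S → d * B S)) ⟩
    e * (X + ∑ˢ (λ S → d * B S))             ≡⟨ cong (λ z → e * (X + z)) (*-distribˡ-∑ˢ d B) ⟨
    e * (X + d * ∑ˢ B)                       ∎
    where
    open ≤-Reasoning
    x : Subset n → ℤ
    x S = di S * (J * α (B S) + β (B S))
    distribute : ∀ s e y d b → s * (e * (y + d * b)) ≡ e * (s * y + d * (s * b))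
    distribute = solve-∀
    pointwise : ∀ S → c * di S ℤ.≤ e * (x S + d * B S)
    pointwise S = begin
      c * di S                                          ≡⟨ *-comm c (di S) ⟩
      di S * c                                          ≤⟨ *-monoˡ-≤-0≤ (0≤𝟙 (isK k S ∧ isDir (lab H S))) (c≤ (B S) (0≤B S)) ⟩
      di S * (e * (J * α (B S) + β (B S) + d * B S))    ≡⟨ distribute (di S) e (J * α (B S) + β (B S)) d (B S) ⟩
      e * (x S + d * (di S * B S))                      ≡⟨ cong (λ z → e * (x S + d * z)) (di*B≡B S) ⟩
      e * (x S + d * B S)                               ∎

  ∑E≡ : ∑ˢ (𝟙 ∘ E) ≡ ∑ˢ un + ∑ˢ di
  ∑E≡ = trans (∑ˢ-cong E≡un+di) (∑ˢ-distrib-+ un di)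

  local-total : J * ∑ˢ B + + 2 * ((M - 1ℤ) * (∑ˢ un + ∑ˢ di)) ℤ.≤ + 2 * ((M - 1ℤ) * #sets n k)
  local-total = subst₂ (λ N e → J * ∑ˢ B + + 2 * (N * e) ℤ.≤ + 2 * (N * #sets n k))
    (shift (+ n) (+ j)) ∑E≡ ∑B-bound
    where
    shift : ∀ a b → a - (1ℤ + b) ≡ (a - b) - 1ℤ
    shift = solve-∀

  edges≤ : ∑ˢ un + ∑ˢ di ℤ.≤ #sets n k
  edges≤ = subst (ℤ._≤ #sets n k) ∑E≡ ∑E≤#sets

-- n ≥ 201(k - 1) yields M ≥ 200(k - 1), as `gain` requires. The bound carries no error term.
turán : ∀ {i n} → 201 ℕ.* suc i ℕ.≤ n → (H : PDG (suc (suc i)) n) → H isFreeOf T (suc (suc i)) →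
  + 17 * + eᵤ H + + 27 * + e𝒹 H ℤ.≤ + 17 * + (n C suc (suc i))
turán {i} {n} n₀≤n H free with r , r-eq ← ℕ.m≤n⇒∃[o]m+o≡n n₀≤n =
  subst₂ (λ U D → + 17 * U + + 27 * D ℤ.≤ + 17 * + (n C suc (suc i)))
    (sym (count-∑ˢ (λ S → isK k S ∧ isUndir (lab H S)))) (sym (count-∑ˢ (λ S → isK k S ∧ isDir (lab H S))))
    (subst (λ N → + 17 * ∑ˢ un + + 27 * ∑ˢ di ℤ.≤ + 17 * N) (∑ˢ-isK n k)
      (combine J K M (#sets n j) (#sets n k) (∑ˢ un) (∑ˢ di) X (∑ˢ B)
        (+<+ (ℕ.s≤s ℕ.z≤n)) (+<+ (ℕ.s≤s ℕ.z≤n)) (0<M r r-eq) (#sets-step n j)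
        link-total local-total edges≤
        (gain-total (+ 3700 * J * J * K * M) (+ 50 * J * J * J * K) (+ 17)
          λ b → gain (+ i) J K M (+ r) b refl refl (M≡ r r-eq) 0≤+n 0≤+n)))
  where
  open Edges H
  open Free H free using (j; k)
  open Bound H free (+ 10 * + suc i) (+ 10 * + suc (suc i)) (+ suc (suc i) * (+ 6 * + suc i + + 5))
  shift : ∀ a r → + 201 * a + r - a ≡ + 200 * a + r
  shift = solve-∀
  M≡ : ∀ r → 201 ℕ.* suc i ℕ.+ r ≡ n → M ≡ + 200 * (+ suc i) + + r
  M≡ r eq = trans (cong (λ m → + m - + suc i) (sym eq))
    (trans (cong (λ a → a + + r - + suc i) (pos-* 201 (suc i))) (shift (+ suc i) (+ r)))
  0<M : ∀ r → 201 ℕ.* suc i ℕ.+ r ≡ n → 0ℤ < M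
  0<M r eq = subst (0ℤ <_) (sym (M≡ r eq))
    (+-mono-<-≤ (0<* {+ 200} {+ suc i} (+<+ (ℕ.s≤s ℕ.z≤n)) (+<+ (ℕ.s≤s ℕ.z≤n))) (0≤+n {r}))

-- The lower bound and the passage to rationals

AllBut-size : ∀ {m} {X : Subset (suc m)} {c} → AllBut X c → ∣ X ∣ ≡ m
AllBut-size {m} {X} {c} B = trans (cong ∣_∣ X≡)
  (ℕ.suc-injective (trans (∣delete∣ ⊤ c (lookup-replicate c true)) (∣⊤∣≡n (suc m))))
  where
  X≡ : X ≡ delete ⊤ c
  X≡ = trans (sym (tabulate∘lookup X)) (trans (tabulate-cong λ i → Bool-ext
    (λ i∈X → ∈-delete ⊤ c i (AllBut.∈⇒≢ B i i∈X) (lookup-replicate i true))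
    (λ i∈ → AllBut.≢⇒∈ B i (∉-delete ⊤ c i i∈))) (tabulate∘lookup (delete ⊤ c)))

labT-E₃ : ∀ k → labT k (E₃ k) ≡ dir (fromℕ k)
labT-E₃ k rewrite dec-true (E₃ k ≟ˢ E₃ k) refl = refl

complete : ∀ k n → PDG k n
complete k n = record { lab = λ _ → undir ; wf = λ _ _ _ () }

-- Directions can be forgotten but not created, so the directed edge `E₃` has no possible image.
complete-free : ∀ j n → complete (suc j) n isFreeOf T (suc j)
complete-free j n (φ , _ , φ-hom)
  with () ← proj₂ (φ-hom (E₃ (suc j)) (AllBut-size (E₃-AllBut j))) (fromℕ (suc j)) (labT-E₃ (suc j))

eᵤ-complete : ∀ k n → eᵤ (complete k n) ≡ n C k
eᵤ-complete k n = +-injective (trans (count-∑ˢ (λ (S : Subset n) → isK k S ∧ true))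
  (trans (∑ˢ-cong {n} λ S → cong 𝟙 (∧-identityʳ (isK k S))) (∑ˢ-isK n k)))

e𝒹-complete : ∀ k n → e𝒹 (complete k n) ≡ 0
e𝒹-complete k n = +-injective (trans (count-∑ˢ (λ (S : Subset n) → isK k S ∧ false))
  (trans (∑ˢ-cong {n} λ S → cong 𝟙 (∧-zeroʳ (isK k S))) (∑ˢ-0 n)))

nCk>0 : ∀ {n k} → k ≤ n → 0 ℕ.< n C k
nCk>0 {n}     {zero}  _         = s≤s z≤n
nCk>0 {suc n} {suc k} (s≤s k≤n) = subst (0 ℕ.<_) (nCk+nC[k+1]≡[n+1]C[k+1] n k)
  (ℕ.<-≤-trans (nCk>0 k≤n) (ℕ.m≤m+n (n C k) (n C suc k)))

θ₀ : ℚ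
θ₀ = + 27 / 17

weighted≤ : ∀ u d c → + 17 * + u + + 27 * + d ℤ.≤ + 17 * + c → toℚ u ℚ.+ θ₀ ℚ.* toℚ d ℚ.≤ toℚ c
weighted≤ u d c h = ℚ.toℚᵘ-cancel-≤ (begin
  toℚᵘ (toℚ u ℚ.+ θ₀ ℚ.* toℚ d)
    ≃⟨ ℚ.toℚᵘ-homo-+ (toℚ u) (θ₀ ℚ.* toℚ d) ⟩
  toℚᵘ (toℚ u) ℚᵘ.+ toℚᵘ (θ₀ ℚ.* toℚ d)
    ≃⟨ ℚᵘ.+-cong (ℚ.toℚᵘ-fromℚᵘ (mkℚᵘ (+ u) 0)) (ℚ.toℚᵘ-homo-* θ₀ (toℚ d)) ⟩
  mkℚᵘ (+ u) 0 ℚᵘ.+ toℚᵘ θ₀ ℚᵘ.* toℚᵘ (toℚ d)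
    ≃⟨ ℚᵘ.+-congʳ (mkℚᵘ (+ u) 0) (ℚᵘ.*-congˡ {toℚᵘ θ₀} (ℚ.toℚᵘ-fromℚᵘ (mkℚᵘ (+ d) 0))) ⟩
  mkℚᵘ (+ u) 0 ℚᵘ.+ mkℚᵘ (+ 27) 16 ℚᵘ.* mkℚᵘ (+ d) 0
    ≤⟨ *≤* (subst₂ ℤ._≤_ (lhs (+ u) (+ d)) (rhs (+ c)) h) ⟩
  mkℚᵘ (+ c) 0
    ≃⟨ ℚ.toℚᵘ-fromℚᵘ (mkℚᵘ (+ c) 0) ⟨
  toℚᵘ (toℚ c) ∎)
  where
  open ℚᵘ.≤-Reasoning
  lhs : ∀ u d → + 17 * u + + 27 * d ≡ (u * + 17 + (+ 27 * d) * 1ℤ) * 1ℤ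
  lhs = solve-∀
  rhs : ∀ c → + 17 * c ≡ c * + 17
  rhs = solve-∀

upper : ∀ i → BoundWorks (T (suc (suc i))) θ₀ 1ℚ
upper i ε 0<ε = 201 ℕ.* suc i , λ n n₀≤n H free →
  ℚ.≤-trans (weighted≤ (eᵤ H) (e𝒹 H) (n C suc (suc i)) (turán n₀≤n H free)) (slack (n C suc (suc i)))
  where
  1≤1+ε : 1ℚ ℚ.≤ 1ℚ ℚ.+ ε
  1≤1+ε = ℚ.+-monoʳ-≤ 1ℚ (ℚ.<⇒≤ 0<ε)
  slack : ∀ c → toℚ c ℚ.≤ (1ℚ ℚ.+ ε) ℚ.* toℚ c
  slack c = subst (ℚ._≤ (1ℚ ℚ.+ ε) ℚ.* toℚ c) (ℚ.*-identityˡ (toℚ c))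
    (ℚ.*-monoʳ-≤-nonNeg (toℚ c) {{ℚ.normalize-nonNeg c 1}} 1≤1+ε)

weighted-complete : ∀ θ k n → weighted θ (complete k n) ≡ toℚ (n C k)
weighted-complete θ k n = trans
  (cong₂ (λ u d → toℚ u ℚ.+ θ ℚ.* toℚ d) (eᵤ-complete k n) (e𝒹-complete k n))
  (trans (cong (toℚ (n C k) ℚ.+_) (ℚ.*-zeroʳ θ)) (ℚ.+-identityʳ (toℚ (n C k))))

p+[q-p]≡q : ∀ p q → p ℚ.+ (q ℚ.- p) ≡ q
p+[q-p]≡q p q = trans (cong (p ℚ.+_) (ℚ.+-comm q (ℚ.- p))) (trans (sym (ℚ.+-assoc p (ℚ.- p) q))
  (trans (cong (ℚ._+ q) (ℚ.+-inverseʳ p)) (ℚ.+-identityˡ q)))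

m*N<N : ∀ {m} N → 0 ℕ.< N → m ℚ.< 1ℚ → m ℚ.* toℚ N ℚ.< toℚ N
m*N<N {m} N 0<N m<1 = subst (m ℚ.* toℚ N ℚ.<_) (ℚ.*-identityˡ (toℚ N))
  (ℚ.*-monoˡ-<-pos (toℚ N) {{ℚ.normalize-pos N 1 {{_}} {{ℕ.>-nonZero 0<N}}}} m<1)

-- The complete undirected PDG has density exactly 1. For m strictly between c and 1, taking ε = m -
-- c would force C(n, k) ≤ m C(n, k).
lower : ∀ j θ c → c ℚ.< 1ℚ → ¬ BoundWorks (T (suc j)) θ c
lower j θ c c<1 works = between (ℚ.<-dense c<1)
  where
  k = suc j
  between : (Σ ℚ λ m → c ℚ.< m × m ℚ.< 1ℚ) → ⊥
  between (m , c<m , m<1) = large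
    (works (m ℚ.- c) (subst (ℚ._< m ℚ.- c) (ℚ.+-inverseʳ c) (ℚ.+-monoˡ-< (ℚ.- c) c<m)))
    where
    large : (Σ ℕ λ n₀ → ∀ n → n₀ ≤ n → (H : PDG k n) → H isFreeOf T k →
               weighted θ H ℚ.≤ (c ℚ.+ (m ℚ.- c)) ℚ.* toℚ (n C k)) → ⊥
    large (n₀ , bound) = ℚ.<-irrefl refl (ℚ.≤-<-trans
      (subst₂ (λ w q → w ℚ.≤ q ℚ.* toℚ (n C k)) (weighted-complete θ k n) (p+[q-p]≡q c m)
        (bound n (ℕ.m≤m+n n₀ k) (complete k n) (complete-free j n)))
      (m*N<N (n C k) (nCk>0 (ℕ.m≤n+m k n₀)) m<1))
      -- Adding k makes C(n, k) positive, so the last inequality is strict.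
      where n = n₀ ℕ.+ k

theorem1p15 : ∀ (k : ℕ) → 2 ≤ k →
    Σ ℚ λ θ → Log₂3< θ × πIs (T k) θ 1ℚ
theorem1p15 (suc (suc i)) _ =
  -- log₂ 3 < 27/17 because 3^17 = 129140163 < 134217728 = 2^27; the denominator is given by its
  -- predecessor 16.
  θ₀ , (27 , 16 , refl , ℕ.<ᵇ⇒< (3 ℕ.^ 17) (2 ℕ.^ 27) _) , upper i , lower (suc i) θ₀
theorem1p15 (suc zero) (s≤s ())
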